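{- For every graph $G$, $$2\,\mathrm{anw}(G)\le \mathrm{lsfw}(G)\le 2\,\mathrm{anw}(G)+2 .$$
   Context: All graphs are finite, simple and undirected. Both parameters $\mathrm{anw}$ and $\mathrm{lsfw}$ are assigned value $0$ on the empty graph. Active neighborhood-width. A layout of $G$ is a linear order $\pi=(v_1,\dots,v_n)$ of $V(G)$; put $P_i=\{v_1,\dots,v_i\}$ for $0\le i\le n$. For $u\in P_i$ let $r_i^\pi(u)=N_G(u)\cap (V(G)\setminus P_i)$ (the row of $u$). Let $\mathcal A_i^\pi=\{r_i^\pi(u):u\in P_i\}\setminus\{\emptyset\}$ be the set of distinct nonzero rows. Then $\mathrm{anw}_\pi(G)=\max_i|\mathcal A_i^\pi|$ and $\mathrm{anw}(G)=\min_\pi \mathrm{anw}_\pi(G)$ over all layouts $\pi$. Sequential cable plays. A configuration on $G$ consists of the set of born vertices, a family $\mathcal L$ of pairwise disjoint nonempty sets of born vertices (the live cables), and a set of already placed edges; initially all are empty. With $\ell=|\mathcal L|$ the number of live cables before a move, the moves are: (i) birth$(S)$: introduces a nonempty set $S$ of fresh (not yet born) vertices of $G$ as one live cable; cost $2\ell+1$. (ii) fold$(X,Y)$: replaces two distinct live cables $X,Y$ by $X\cup Y$; cost $2\ell-1$. (iii) block$(X,Y)$: places every edge between two distinct live cables $X,Y$; legal when all these pairs are edges of $G$ and at least one has not already been placed; cost $2\ell$. (iv) clique$(X)$: places every edge inside a live cable $X$; legal when $X$ is a clique of $G$ and at least one internal edge has not already been placed; cost $2\ell$. (v) close$(X)$: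 removes the live cable $X$; legal when every edge of $G$ incident with a vertex of $X$ has already been placed; cost $2\ell-1$. A play (a finite sequence of legal moves from the initial configuration) constructs $G$ if every vertex is born, every edge of $G$ is placed, and every cable is closed. The width of a play is the maximum cost of its moves, and $\mathrm{lsfw}(G)$ is the minimum width of a play constructing $G$. -}

module Defs where

open import Data.Bool.Properties as Bool using ()
open import Data.Fin using (Fin; zero; suc; toℕ)
import Data.Fin.Properties as Fin
open import Data.Fin.Permutation as Perm
  using (Permutation′; _⟨$⟩ʳ_; _⟨$⟩ˡ_; inverseˡ; inverseʳ)
open import Data.Fin.Subset
  using (Subset; _∈_; _∉_; _⊆_; _∩_; _∪_; ∁; ⁅_⁆; ∣_∣; Nonempty; Empty) renaming (⊥ to ∅)
open import Data.Fin.Subset.Properties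
  using (_∈?_; nonempty?; anySubset?; x∈p∩q⁺; x∈p∩q⁻; x∈p∪q⁺; x∈p∪q⁻; ∉⊥; x∈⁅x⁆; x∈⁅y⁆⇒x≡y;
         p⊂q⇒∣p∣<∣q∣; p⊆q⇒∣p∣≤∣q∣; p⊂q⇒∁p⊃∁q; p⊆q⇒∁p⊇∁q; p⊆p∪q)
open import Data.List using (List; []; _∷_; length; map; filter; deduplicate; upTo; allFin)
open import Data.List.Extrema.Nat using (max)
open import Data.List.Membership.Propositional using (lose) renaming (_∈_ to _∈ˡ_)
open import Data.List.Membership.Propositional.Properties using (∈-filter⁺; ∈-filter⁻; ∈-allFin)
import Data.List.Membership.DecPropositional as DecMembership
open import Data.List.Properties using (filter-notAll; map-cong)
open import Data.List.Relation.Unary.All as All using (All; []; _∷_)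
import Data.List.Relation.Unary.All.Properties as All
open import Data.List.Relation.Unary.AllPairs using (AllPairs; []; _∷_)
import Data.List.Relation.Unary.AllPairs.Properties as AllPairs
open import Data.List.Relation.Unary.Any using (here; there)
open import Data.Nat using (ℕ; zero; suc; _+_; _*_; _∸_; _⊔_; _≤_; _<_; z≤n; s≤s; _<?_)
open import Data.Nat.Induction using (<-wellFounded)
open import Data.Nat.ListAction using (sum)
import Data.Nat.Properties as ℕ
open import Data.Product using (Σ; ∃; ∃₂; _×_; _,_; proj₁; proj₂)
open import Data.Sum using (_⊎_; inj₁; inj₂; [_,_]′)
import Data.Vec as Vec
import Data.Vec.Properties as Vec
open import Function using (_∘_)
open import Induction.WellFounded using (Acc; acc)
open import Level using (0ℓ)
open import Relation.Binary using (DecidableEquality)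
open import Relation.Binary.PropositionalEquality
  using (_≡_; _≢_; refl; sym; trans; cong; subst; ≢-sym)
open import Relation.Nullary using (Dec; yes; no; ¬_; ¬?; does; contradiction)
open import Relation.Nullary.Decidable
  using (_×-dec_; _⊎-dec_; _→-dec_; map′; dec-true; decidable-stable)
open import Relation.Unary using (Pred; Decidable)

infix 4 _≟ˢ_

_≟ˢ_ : ∀ {n} → DecidableEquality (Subset n)
_≟ˢ_ = Vec.≡-dec Bool._≟_

Disjoint : ∀ {n} → Subset n → Subset n → Set
Disjoint X Y = Empty (X ∩ Y)

-- ⟪ P? ⟫ is the set of all v with P v.
⟪_⟫ : ∀ {n} {P : Pred (Fin n) 0ℓ} → Decidable P → Subset n
⟪ P? ⟫ = Vec.tabulate (does ∘ P?)

∈⟪⟫⁺ : ∀ {n} {P : Pred (Fin n) 0ℓ} (P? : Decidable P) {v : Fin n} → P v → v ∈ ⟪ P? ⟫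
∈⟪⟫⁺ P? {v} p =
  Vec.lookup⇒[]= v _ (trans (Vec.lookup∘tabulate (does ∘ P?) v) (dec-true (P? v) p))

∈⟪⟫⁻ : ∀ {n} {P : Pred (Fin n) 0ℓ} (P? : Decidable P) {v : Fin n} → v ∈ ⟪ P? ⟫ → P v
∈⟪⟫⁻ P? {v} v∈
  with P? v | trans (sym (Vec.lookup∘tabulate (does ∘ P?) v)) (Vec.[]=⇒lookup v∈)
... | yes p | _ = p
... | no _  | ()

record Minimum (P : Pred ℕ 0ℓ) : Set where
  field
    value    : ℕ
    attained : P value
    minimal  : ∀ {j} → P j → value ≤ j

minimum : ∀ {P : Pred ℕ 0ℓ} → Decidable P → ∀ k → P k → Minimum P
minimum P? zero    p = record { value = 0 ; attained = p ; minimal = λ _ → z≤n }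
minimum {P} P? (suc k) p with P? 0
... | yes p₀ = record { value = 0 ; attained = p₀ ; minimal = λ _ → z≤n }
... | no ¬p₀ = record { value = suc value ; attained = attained ; minimal = min }
  where
  open Minimum (minimum (P? ∘ suc) k p)
  min : ∀ {j} → P j → suc value ≤ j
  min {zero}  q = contradiction q ¬p₀
  min {suc j} q = s≤s (minimal q)

-- N u is the open neighbourhood of u: uv is an edge iff v ∈ N u.

record Graph : Set where
  field
    order    : ℕ
    N        : Fin order → Subset order
    N-sym    : ∀ {u v} → v ∈ N u → u ∈ N v
    N-irrefl : ∀ {u} → u ∉ N u

module _ (G : Graph) where
  open Graph G

  -- The layout (v₁,…,vₙ) is the permutation with π ⟨$⟩ʳ i = vᵢ₊₁ for i : Fin n,
  -- so π ⟨$⟩ˡ v is the zero-based position of v.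
  Layout : Set
  Layout = Permutation′ order

  prefix : Layout → ℕ → Subset order
  prefix π i = ⟪ (λ v → toℕ (π ⟨$⟩ˡ v) <? i) ⟫

  row : Layout → ℕ → Fin order → Subset order
  row π i u = N u ∩ ∁ (prefix π i)

  -- A repetition-free list, so that its length is the number of distinct nonzero rows.
  activeRows : Layout → ℕ → List (Subset order)
  activeRows π i =
    deduplicate _≟ˢ_ (filter nonempty? (map (row π i) (filter (_∈? prefix π i) (allFin order))))

  -- The default 0 of max is harmless: the list of values is nonempty.  On the graph without
  -- vertices the only value is 0.
  layoutWidth : Layout → ℕ
  layoutWidth π = max 0 (map (λ i → length (activeRows π i)) (upTo (suc order)))

IsLayoutWidth : Graph → Pred ℕ 0ℓ
IsLayoutWidth G k = ∃ λ (π : Layout G) → layoutWidth G π ≡ k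

-- Decidability of IsLayoutWidth, by exhausting all permutations.

≈⇒≈ˡ : ∀ {n} (π ρ : Permutation′ n) → π Perm.≈ ρ → ∀ v → π ⟨$⟩ˡ v ≡ ρ ⟨$⟩ˡ v
≈⇒≈ˡ π ρ π≈ρ v =
  trans (cong (π ⟨$⟩ˡ_) (trans (sym (inverseʳ ρ)) (sym (π≈ρ (ρ ⟨$⟩ˡ v))))) (inverseˡ π)

layoutWidth-cong : ∀ G (π ρ : Layout G) → π Perm.≈ ρ → layoutWidth G π ≡ layoutWidth G ρ
layoutWidth-cong G π ρ π≈ρ =
  cong (max 0) (map-cong (cong length ∘ activeRows-cong) (upTo (suc order)))
  where
  open Graph G
  prefix-cong : ∀ i → prefix G π i ≡ prefix G ρ i
  prefix-cong i = Vec.tabulate-cong λ v →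
    cong (λ j → does (toℕ j <? i)) (≈⇒≈ˡ π ρ π≈ρ v)
  activeRows-cong : ∀ i → activeRows G π i ≡ activeRows G ρ i
  activeRows-cong i = cong
    (λ P → deduplicate _≟ˢ_
             (filter nonempty? (map (λ u → N u ∩ ∁ P) (filter (_∈? P) (allFin order)))))
    (prefix-cong i)

anyPermutation? : ∀ {n} {P : Pred (Permutation′ n) 0ℓ} →
                  (∀ π ρ → π Perm.≈ ρ → P π → P ρ) → Decidable P → Dec (∃ P)
anyPermutation? {zero} resp P? =
  map′ (Perm.id ,_) (λ (π , p) → resp π Perm.id (λ ()) p) (P? Perm.id)
anyPermutation? {suc n} {P} resp P? = map′ to from
  (Fin.any? λ j → anyPermutation? (λ π ρ π≈ρ → resp _ _ (insert-cong j π ρ π≈ρ))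
                                  (λ π → P? (Perm.insert zero j π)))
  where
  insert-cong : ∀ j (π ρ : Permutation′ n) → π Perm.≈ ρ →
                Perm.insert zero j π Perm.≈ Perm.insert zero j ρ
  insert-cong j π ρ π≈ρ zero    = refl
  insert-cong j π ρ π≈ρ (suc i) = cong (Data.Fin.punchIn j) (π≈ρ i)
  to : (∃ λ j → ∃ λ π → P (Perm.insert zero j π)) → ∃ P
  to (j , π , p) = Perm.insert zero j π , p
  from : ∃ P → ∃ λ j → ∃ λ π → P (Perm.insert zero j π)
  from (π , p) = π ⟨$⟩ʳ zero , Perm.remove zero π
               , resp _ _ (sym ∘ Perm.insert-remove zero π) p

anwMinimum : ∀ G → Minimum (IsLayoutWidth G)
anwMinimum G = minimum
  (λ k → anyPermutation? (λ π ρ π≈ρ → trans (sym (layoutWidth-cong G π ρ π≈ρ)))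
                         (λ π → layoutWidth G π ℕ.≟ k))
  (layoutWidth G Perm.id) (Perm.id , refl)

anw : Graph → ℕ
anw G = Minimum.value (anwMinimum G)

data Move (n : ℕ) : Set where
  birth  : (S : Subset n) → Move n
  fold   : (X Y : Subset n) → Move n
  block  : (X Y : Subset n) → Move n
  clique : (X : Subset n) → Move n
  close  : (X : Subset n) → Move n

-- placed u is the set of all v such that the edge uv has been placed.  The conditions on
-- configurations (live cables are nonempty, pairwise disjoint and born) are not fields but
-- are collected in Valid, which holds for every configuration reached by a play
-- (initial-Valid, apply-Valid).  In particular the list live then has no repetitions, so
-- its length is the number of live cables.
record Config (n : ℕ) : Set where
  field
    born   : Subset n
    live   : List (Subset n)
    placed : Fin n → Subset n

  ℓ : ℕ
  ℓ = length live

initial : ∀ {n} → Config n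
initial = record { born = ∅ ; live = [] ; placed = λ _ → ∅ }

infixl 6 _without_

_without_ : ∀ {n} → List (Subset n) → Subset n → List (Subset n)
L without X = filter (λ Z → ¬? (Z ≟ˢ X)) L

cost : ∀ {n} → Config n → Move n → ℕ
cost c (birth S)   = 2 * Config.ℓ c + 1
cost c (fold X Y)  = 2 * Config.ℓ c ∸ 1
cost c (block X Y) = 2 * Config.ℓ c
cost c (clique X)  = 2 * Config.ℓ c
cost c (close X)   = 2 * Config.ℓ c ∸ 1

module _ (G : Graph) where
  open Graph G

  Legal : Config order → Move order → Set
  Legal c (birth S)   = Nonempty S × Disjoint S (Config.born c)
  Legal c (fold X Y)  = X ∈ˡ Config.live c × Y ∈ˡ Config.live c × X ≢ Y
  Legal c (block X Y) = X ∈ˡ Config.live c × Y ∈ˡ Config.live c × X ≢ Y ×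
                        (∀ u v → u ∈ X → v ∈ Y → v ∈ N u) ×
                        (∃₂ λ u v → u ∈ X × v ∈ Y × v ∉ Config.placed c u)
  Legal c (clique X)  = X ∈ˡ Config.live c ×
                        (∀ u v → u ∈ X → v ∈ X → u ≢ v → v ∈ N u) ×
                        (∃₂ λ u v → u ∈ X × v ∈ X × v ∈ N u × v ∉ Config.placed c u)
  Legal c (close X)   = X ∈ˡ Config.live c ×
                        (∀ u v → u ∈ X → v ∈ N u → v ∈ Config.placed c u)

  across? : (X Y : Subset order) (u : Fin order) →
            Decidable (λ v → (u ∈ X × v ∈ Y) ⊎ (u ∈ Y × v ∈ X))
  across? X Y u v = (u ∈? X ×-dec v ∈? Y) ⊎-dec (u ∈? Y ×-dec v ∈? X)

  within? : (X : Subset order) (u : Fin order) → Decidable (λ v → u ∈ X × v ∈ X)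
  within? X u v = u ∈? X ×-dec v ∈? X

  apply : Config order → Move order → Config order
  apply c (birth S) = record
    { born = Config.born c ∪ S ; live = S ∷ Config.live c ; placed = Config.placed c }
  apply c (fold X Y) = record c { live = (X ∪ Y) ∷ (Config.live c without X without Y) }
  apply c (block X Y) = record c { placed = λ u → Config.placed c u ∪ (N u ∩ ⟪ across? X Y u ⟫) }
  apply c (clique X) = record c { placed = λ u → Config.placed c u ∪ (N u ∩ ⟪ within? X u ⟫) }
  apply c (close X) = record c { live = Config.live c without X }

  infixr 5 _∷_

  data Play : Config order → Config order → Set where
    []  : ∀ {c} → Play c c
    _∷_ : ∀ {c d m} → Legal c m → Play (apply c m) d → Play c d

  -- The empty play has width 0; it constructs only the graph without vertices, for which
  -- it gives lsfw the conventional value 0.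
  width : ∀ {c d} → Play c d → ℕ
  width []                = 0
  width (_∷_ {c} {_} {m} _ p) = cost c m ⊔ width p

  -- A play constructs G if it leads from initial to a finished configuration.
  Finished : Config order → Set
  Finished c = (∀ v → v ∈ Config.born c) ×
               (∀ u v → v ∈ N u → v ∈ Config.placed c u) ×
               Config.live c ≡ []

  FinishableFrom : Config order → Pred ℕ 0ℓ
  FinishableFrom c k = ∃ λ d → Σ (Play c d) λ p → Finished d × width p ≡ k

  record Valid (c : Config order) : Set where
    open Config c
    field
      live-nonempty : All Nonempty live
      live-disjoint : AllPairs Disjoint live
      live-born     : All (_⊆ born) live
      placed-edge   : ∀ {u v} → v ∈ placed u → v ∈ N u
      placed-sym    : ∀ {u v} → v ∈ placed u → u ∈ placed v

IsPlayWidth : Graph → Pred ℕ 0ℓ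
IsPlayWidth G = FinishableFrom G initial

Disjoint-sym : ∀ {n} {X Y : Subset n} → Disjoint X Y → Disjoint Y X
Disjoint-sym {X = X} {Y} XY (v , v∈) with x∈p∩q⁻ Y X v∈
... | v∈Y , v∈X = XY (v , x∈p∩q⁺ (v∈X , v∈Y))

∪-Disjoint : ∀ {n} {X Y Z : Subset n} → Disjoint X Z → Disjoint Y Z → Disjoint (X ∪ Y) Z
∪-Disjoint {X = X} {Y} {Z} XZ YZ (v , v∈) with x∈p∩q⁻ (X ∪ Y) Z v∈
... | v∈X∪Y , v∈Z with x∈p∪q⁻ X Y v∈X∪Y
...   | inj₁ v∈X = XZ (v , x∈p∩q⁺ (v∈X , v∈Z))
...   | inj₂ v∈Y = YZ (v , x∈p∩q⁺ (v∈Y , v∈Z))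

AllPairs-Disjoint : ∀ {n} {L : List (Subset n)} {X Y} →
                    AllPairs Disjoint L → X ∈ˡ L → Y ∈ˡ L → X ≢ Y → Disjoint X Y
AllPairs-Disjoint _        (here refl) (here refl) X≢Y = contradiction refl X≢Y
AllPairs-Disjoint (ds ∷ _) (here refl) (there Y∈)  _   = All.lookup ds Y∈
AllPairs-Disjoint (ds ∷ _) (there X∈)  (here refl) _   = Disjoint-sym (All.lookup ds X∈)
AllPairs-Disjoint (_ ∷ ds) (there X∈)  (there Y∈)  X≢Y = AllPairs-Disjoint ds X∈ Y∈ X≢Y

∈-without⁺ : ∀ {n} {L : List (Subset n)} {X Z} → Z ∈ˡ L → Z ≢ X → Z ∈ˡ L without X
∈-without⁺ {X = X} = ∈-filter⁺ (λ Z → ¬? (Z ≟ˢ X))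

∈-without⁻ : ∀ {n} {L : List (Subset n)} {X Z} → Z ∈ˡ L without X → Z ∈ˡ L × Z ≢ X
∈-without⁻ {X = X} = ∈-filter⁻ (λ Z → ¬? (Z ≟ˢ X))

length-without : ∀ {n} {L : List (Subset n)} {X} → X ∈ˡ L → length (L without X) < length L
length-without {L = L} {X} X∈ =
  filter-notAll (λ Z → ¬? (Z ≟ˢ X)) L (lose X∈ (λ X≢X → X≢X refl))

module _ (G : Graph) where
  open Graph G

  initial-Valid : Valid G initial
  initial-Valid = record
    { live-nonempty = []
    ; live-disjoint = []
    ; live-born     = []
    ; placed-edge   = λ v∈∅ → contradiction v∈∅ ∉⊥
    ; placed-sym    = λ v∈∅ → contradiction v∈∅ ∉⊥
    }

  private
    place : ∀ {c} → Valid G c → {R : Fin order → Fin order → Set} (R? : ∀ u → Decidable (R u)) →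
            (∀ {u v} → R u v → R v u) →
            Valid G (record c { placed = λ u → Config.placed c u ∪ (N u ∩ ⟪ R? u ⟫) })
    place {c} val R? R-sym = record
      { Valid val
      ; placed-edge = λ {u} → [ placed-edge , proj₁ ∘ x∈p∩q⁻ (N u) _ ]′ ∘ x∈p∪q⁻ (placed u) _
      ; placed-sym  = λ {u} {v} → x∈p∪q⁺ ∘ [ inj₁ ∘ placed-sym , inj₂ ∘ flipped u v ]′
                                  ∘ x∈p∪q⁻ (placed u) _
      }
      where
      open Config c
      open Valid val
      flipped : ∀ u v → v ∈ N u ∩ ⟪ R? u ⟫ → u ∈ N v ∩ ⟪ R? v ⟫
      flipped u v v∈ with x∈p∩q⁻ (N u) _ v∈
      ... | v∈N , v∈R = x∈p∩q⁺ (N-sym v∈N , ∈⟪⟫⁺ (R? v) (R-sym (∈⟪⟫⁻ (R? u) v∈R)))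

  apply-Valid : ∀ {c} m → Valid G c → Legal G c m → Valid G (apply G c m)
  apply-Valid {c} (birth S) val (S≢∅ , S∩born) = record
    { live-nonempty = S≢∅ ∷ live-nonempty
    ; live-disjoint = All.map S-disjoint live-born ∷ live-disjoint
    ; live-born     = S⊆ ∷ All.map weaken live-born
    ; placed-edge   = placed-edge
    ; placed-sym    = placed-sym
    }
    where
    open Config c
    open Valid val
    S⊆ : S ⊆ born ∪ S
    S⊆ v∈S = x∈p∪q⁺ (inj₂ v∈S)
    weaken : ∀ {X} → X ⊆ born → X ⊆ born ∪ S
    weaken X⊆ v∈X = x∈p∪q⁺ (inj₁ (X⊆ v∈X))
    S-disjoint : ∀ {X} → X ⊆ born → Disjoint S X
    S-disjoint {X} X⊆ (v , v∈) with x∈p∩q⁻ S X v∈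
    ... | v∈S , v∈X = S∩born (v , x∈p∩q⁺ (v∈S , X⊆ v∈X))
  apply-Valid {c} (fold X Y) val (X∈ , Y∈ , _) = record
    { live-nonempty = X∪Y≢∅ (All.lookup live-nonempty X∈)
                      ∷ All.filter⁺ _ (All.filter⁺ _ live-nonempty)
    ; live-disjoint = All.tabulate X∪Y-disjoint ∷ AllPairs.filter⁺ _ (AllPairs.filter⁺ _ live-disjoint)
    ; live-born     = [ All.lookup live-born X∈ , All.lookup live-born Y∈ ]′ ∘ x∈p∪q⁻ X Y
                      ∷ All.filter⁺ _ (All.filter⁺ _ live-born)
    ; placed-edge   = placed-edge
    ; placed-sym    = placed-sym
    }
    where
    open Config c
    open Valid val
    X∪Y≢∅ : Nonempty X → Nonempty (X ∪ Y)
    X∪Y≢∅ (v , v∈X) = v , x∈p∪q⁺ (inj₁ v∈X)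
    X∪Y-disjoint : ∀ {Z} → Z ∈ˡ live without X without Y → Disjoint (X ∪ Y) Z
    X∪Y-disjoint Z∈ with ∈-without⁻ {L = live without X} {Y} Z∈
    ... | Z∈′ , Z≢Y with ∈-without⁻ {L = live} {X} Z∈′
    ...   | Z∈″ , Z≢X = ∪-Disjoint (AllPairs-Disjoint live-disjoint X∈ Z∈″ (≢-sym Z≢X))
                                   (AllPairs-Disjoint live-disjoint Y∈ Z∈″ (≢-sym Z≢Y))
  apply-Valid (block X Y) val _ =
    place val (across? G X Y) λ where
      (inj₁ (u∈X , v∈Y)) → inj₂ (v∈Y , u∈X)
      (inj₂ (u∈Y , v∈X)) → inj₁ (v∈X , u∈Y)
  apply-Valid (clique X) val _ = place val (within? G X) (λ (u∈X , v∈X) → v∈X , u∈X)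
  apply-Valid (close X) val _ = record
    { live-nonempty = All.filter⁺ _ live-nonempty
    ; live-disjoint = AllPairs.filter⁺ _ live-disjoint
    ; live-born     = All.filter⁺ _ live-born
    ; placed-edge   = placed-edge
    ; placed-sym    = placed-sym
    }
    where open Valid val

-- Every legal move decreases the potential, so all plays are of bounded length.

sum-map-≤ : ∀ {A : Set} (f g : A → ℕ) (xs : List A) →
            (∀ x → f x ≤ g x) → sum (map f xs) ≤ sum (map g xs)
sum-map-≤ f g []       f≤g = z≤n
sum-map-≤ f g (x ∷ xs) f≤g = ℕ.+-mono-≤ (f≤g x) (sum-map-≤ f g xs f≤g)

sum-map-< : ∀ {A : Set} (f g : A → ℕ) {xs : List A} {x} →
            (∀ y → f y ≤ g y) → x ∈ˡ xs → f x < g x → sum (map f xs) < sum (map g xs)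
sum-map-< f g {_ ∷ xs} f≤g (here refl) fx<gx = ℕ.+-mono-<-≤ fx<gx (sum-map-≤ f g xs f≤g)
sum-map-< f g {y ∷ _}  f≤g (there x∈)  fx<gx = ℕ.+-mono-≤-< (f≤g y) (sum-map-< f g f≤g x∈ fx<gx)

∁-∪-≤ : ∀ {n} (p q : Subset n) → ∣ ∁ (p ∪ q) ∣ ≤ ∣ ∁ p ∣
∁-∪-≤ p q = p⊆q⇒∣p∣≤∣q∣ (p⊆q⇒∁p⊇∁q (p⊆p∪q {p = p} q))

∁-∪-< : ∀ {n} (p q : Subset n) {v} → v ∉ p → v ∈ q → ∣ ∁ (p ∪ q) ∣ < ∣ ∁ p ∣
∁-∪-< p q {v} v∉p v∈q =
  p⊂q⇒∣p∣<∣q∣ (p⊂q⇒∁p⊃∁q (p⊆p∪q {p = p} q , v , x∈p∪q⁺ (inj₂ v∈q) , v∉p))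

unplaced : ∀ {n} → (Fin n → Subset n) → ℕ
unplaced {n} placed = sum (map (λ u → ∣ ∁ (placed u) ∣) (allFin n))

potential : ∀ {n} → Config n → ℕ
potential c = 2 * ∣ ∁ born ∣ + ℓ + unplaced placed
  where open Config c

module _ (G : Graph) where
  open Graph G

  private
    place-< : ∀ (placed Q : Fin order → Subset order) u v → v ∉ placed u → v ∈ Q u →
              unplaced (λ w → placed w ∪ Q w) < unplaced placed
    place-< placed Q u v v∉ v∈ =
      sum-map-< _ _ (λ w → ∁-∪-≤ (placed w) (Q w)) (∈-allFin u) (∁-∪-< (placed u) (Q u) v∉ v∈)

  apply-potential : ∀ {c} m → Legal G c m → potential (apply G c m) < potential c
  apply-potential {c} (birth S) ((v , v∈S) , S∩born) = ℕ.+-monoˡ-< (unplaced placed) (begin-strict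
    2 * b′ + suc ℓ    ≡⟨ ℕ.+-suc (2 * b′) ℓ ⟩
    suc (2 * b′) + ℓ  <⟨ ℕ.+-monoˡ-< ℓ (ℕ.n<1+n (suc (2 * b′))) ⟩
    2 + 2 * b′ + ℓ    ≡⟨ cong (_+ ℓ) (ℕ.*-suc 2 b′) ⟨
    2 * suc b′ + ℓ    ≤⟨ ℕ.+-monoˡ-≤ ℓ (ℕ.*-monoʳ-≤ 2 b′<b) ⟩
    2 * ∣ ∁ born ∣ + ℓ ∎)
    where
    open Config c
    open ℕ.≤-Reasoning
    b′ = ∣ ∁ (born ∪ S) ∣
    b′<b : b′ < ∣ ∁ born ∣
    b′<b = ∁-∪-< born S (λ v∈born → S∩born (v , x∈p∩q⁺ (v∈S , v∈born))) v∈S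
  apply-potential {c} (fold X Y) (X∈ , Y∈ , X≢Y) =
    ℕ.+-monoˡ-< (unplaced placed) (ℕ.+-monoʳ-< (2 * ∣ ∁ born ∣) (ℕ.≤-<-trans
      (length-without (∈-without⁺ Y∈ (≢-sym X≢Y))) (length-without X∈)))
    where open Config c
  apply-potential {c} (block X Y) (_ , _ , _ , edges , u , v , u∈X , v∈Y , v∉) =
    ℕ.+-monoʳ-< (2 * ∣ ∁ born ∣ + ℓ) (place-< placed _ u v v∉
      (x∈p∩q⁺ (edges u v u∈X v∈Y , ∈⟪⟫⁺ (across? G X Y u) (inj₁ (u∈X , v∈Y)))))
    where open Config c
  apply-potential {c} (clique X) (_ , _ , u , v , u∈X , v∈X , v∈N , v∉) =
    ℕ.+-monoʳ-< (2 * ∣ ∁ born ∣ + ℓ) (place-< placed _ u v v∉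
      (x∈p∩q⁺ (v∈N , ∈⟪⟫⁺ (within? G X u) (u∈X , v∈X))))
    where open Config c
  apply-potential {c} (close X) (X∈ , _) =
    ℕ.+-monoˡ-< (unplaced placed) (ℕ.+-monoʳ-< (2 * ∣ ∁ born ∣) (length-without X∈))
    where open Config c

-- Decidability of IsPlayWidth, by searching all plays.

anyMove? : ∀ {n} {P : Pred (Move n) 0ℓ} → Decidable P → Dec (∃ P)
anyMove? {P = P} P? = map′ to from
  (anySubset? (P? ∘ birth)
   ⊎-dec anySubset? (λ X → anySubset? (P? ∘ fold X))
   ⊎-dec anySubset? (λ X → anySubset? (P? ∘ block X))
   ⊎-dec anySubset? (P? ∘ clique)
   ⊎-dec anySubset? (P? ∘ close))
  where
  Some : Set
  Some = (∃ λ S → P (birth S)) ⊎ (∃₂ λ X Y → P (fold X Y)) ⊎ (∃₂ λ X Y → P (block X Y))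
         ⊎ (∃ λ X → P (clique X)) ⊎ (∃ λ X → P (close X))
  to : Some → ∃ P
  to (inj₁ (S , p))                             = birth S , p
  to (inj₂ (inj₁ (X , Y , p)))                  = fold X Y , p
  to (inj₂ (inj₂ (inj₁ (X , Y , p))))           = block X Y , p
  to (inj₂ (inj₂ (inj₂ (inj₁ (X , p)))))        = clique X , p
  to (inj₂ (inj₂ (inj₂ (inj₂ (X , p)))))        = close X , p
  from : ∃ P → Some
  from (birth S , p)   = inj₁ (S , p)
  from (fold X Y , p)  = inj₂ (inj₁ (X , Y , p))
  from (block X Y , p) = inj₂ (inj₂ (inj₁ (X , Y , p)))
  from (clique X , p)  = inj₂ (inj₂ (inj₂ (inj₁ (X , p))))
  from (close X , p)   = inj₂ (inj₂ (inj₂ (inj₂ (X , p))))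

module _ (G : Graph) where
  open Graph G
  open DecMembership (_≟ˢ_ {order}) using () renaming (_∈?_ to _∈ˡ?_)

  legal? : ∀ c → Decidable (Legal G c)
  legal? c (birth S)   = nonempty? S ×-dec ¬? (nonempty? (S ∩ Config.born c))
  legal? c (fold X Y)  = X ∈ˡ? Config.live c ×-dec Y ∈ˡ? Config.live c ×-dec ¬? (X ≟ˢ Y)
  legal? c (block X Y) =
    X ∈ˡ? Config.live c ×-dec Y ∈ˡ? Config.live c ×-dec ¬? (X ≟ˢ Y)
    ×-dec (Fin.all? λ u → Fin.all? λ v → u ∈? X →-dec v ∈? Y →-dec v ∈? N u)
    ×-dec (Fin.any? λ u → Fin.any? λ v → u ∈? X ×-dec v ∈? Y ×-dec ¬? (v ∈? Config.placed c u))
  legal? c (clique X)  =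
    X ∈ˡ? Config.live c
    ×-dec (Fin.all? λ u → Fin.all? λ v → u ∈? X →-dec v ∈? X →-dec ¬? (u Fin.≟ v) →-dec v ∈? N u)
    ×-dec (Fin.any? λ u → Fin.any? λ v →
             u ∈? X ×-dec v ∈? X ×-dec v ∈? N u ×-dec ¬? (v ∈? Config.placed c u))
  legal? c (close X)   =
    X ∈ˡ? Config.live c
    ×-dec (Fin.all? λ u → Fin.all? λ v → u ∈? X →-dec v ∈? N u →-dec v ∈? Config.placed c u)

  finished? : Decidable (Finished G)
  finished? c =
    Fin.all? (_∈? Config.born c)
    ×-dec (Fin.all? λ u → Fin.all? λ v → v ∈? N u →-dec v ∈? Config.placed c u)
    ×-dec empty? (Config.live c)
    where
    empty? : (L : List (Subset order)) → Dec (L ≡ [])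
    empty? []      = yes refl
    empty? (_ ∷ _) = no λ ()

  finishable? : ∀ c → Acc _<_ (potential c) → Decidable (FinishableFrom G c)
  finishable? c (acc rs) k = map′ to from
    ((finished? c ×-dec (0 ℕ.≟ k)) ⊎-dec anyMove? first?)
    where
    First : Pred (Move order) 0ℓ
    First m = Legal G c m ×
              ∃ λ (j : Fin (suc k)) → FinishableFrom G (apply G c m) (toℕ j) × cost c m ⊔ toℕ j ≡ k
    first? : Decidable First
    first? m with legal? c m
    ... | no ¬l = no (¬l ∘ proj₁)
    ... | yes l = map′ (l ,_) proj₂ (Fin.any? λ j →
      finishable? (apply G c m) (rs (apply-potential G m l)) (toℕ j)
      ×-dec (cost c m ⊔ toℕ j ℕ.≟ k))
    to : (Finished G c × 0 ≡ k) ⊎ ∃ First → FinishableFrom G c k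
    to (inj₁ (fin , 0≡k)) = c , [] , fin , 0≡k
    to (inj₂ (m , l , j , (d , p , fin , refl′) , eq)) =
      d , l ∷ p , fin , trans (cong (cost c m ⊔_) refl′) eq
    from : FinishableFrom G c k → (Finished G c × 0 ≡ k) ⊎ ∃ First
    from (_ , [] , fin , 0≡k) = inj₁ (fin , 0≡k)
    from (d , _∷_ {m = m} l p , fin , eq) =
      inj₂ (m , l , j , (d , p , fin , sym j≡) , trans (cong (cost c m ⊔_) j≡) eq)
      where
      w<1+k : width G p < suc k
      w<1+k = s≤s (subst (width G p ≤_) eq (ℕ.m≤n⊔m (cost c m) (width G p)))
      j = Data.Fin.fromℕ< w<1+k
      j≡ : toℕ j ≡ width G p
      j≡ = Fin.toℕ-fromℕ< w<1+k

-- Every graph has a constructing play: bear all vertices as singletons, place every edge by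
-- a block, close all cables.

module _ (G : Graph) where
  open Graph G

  record Simple (c : Config order) : Set where
    open Config c
    field
      valid     : Valid G c
      singleton : ∀ {X} → X ∈ˡ live → ∃ λ v → X ≡ ⁅ v ⁆
      pending   : ∀ {u} → u ∈ born → ⁅ u ⁆ ∈ˡ live ⊎ (∀ v → v ∈ N u → v ∈ placed u)

  initial-Simple : Simple initial
  initial-Simple = record
    { valid     = initial-Valid G
    ; singleton = λ ()
    ; pending   = λ u∈∅ → contradiction u∈∅ ∉⊥
    }

  NextMove : Config order → Set
  NextMove c = ∃ λ m → Legal G c m × Simple (apply G c m)

  private
    birth-next : ∀ {c} v → v ∉ Config.born c → Simple c → NextMove c
    birth-next {c} v v∉ simple = birth ⁅ v ⁆ , legal , record
      { valid     = apply-Valid G (birth ⁅ v ⁆) valid legal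
      ; singleton = λ where
          (here refl) → v , refl
          (there X∈)  → singleton X∈
      ; pending   = pending′ ∘ x∈p∪q⁻ born ⁅ v ⁆
      }
      where
      open Config c
      open Simple simple
      legal : Legal G c (birth ⁅ v ⁆)
      legal = (v , x∈⁅x⁆ v) , λ (u , u∈) → let (u∈v , u∈born) = x∈p∩q⁻ ⁅ v ⁆ born u∈ in
              v∉ (subst (_∈ born) (x∈⁅y⁆⇒x≡y v u∈v) u∈born)
      pending′ : ∀ {u} → u ∈ born ⊎ u ∈ ⁅ v ⁆ →
                 ⁅ u ⁆ ∈ˡ ⁅ v ⁆ ∷ live ⊎ (∀ w → w ∈ N u → w ∈ placed u)
      pending′ (inj₂ u∈v) = inj₁ (here (cong ⁅_⁆ (x∈⁅y⁆⇒x≡y v u∈v)))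
      pending′ (inj₁ u∈) with pending u∈
      ... | inj₁ u∈live = inj₁ (there u∈live)
      ... | inj₂ done   = inj₂ done

    block-next : ∀ {c} u v → v ∈ N u → v ∉ Config.placed c u →
                 (∀ w → w ∈ Config.born c) → Simple c → NextMove c
    block-next {c} u v v∈N v∉ allBorn simple = block ⁅ u ⁆ ⁅ v ⁆ , legal , record
      { valid     = apply-Valid G (block ⁅ u ⁆ ⁅ v ⁆) valid legal
      ; singleton = singleton
      ; pending   = λ w∈ → [ inj₁ , (λ done → inj₂ λ x x∈ → x∈p∪q⁺ (inj₁ (done x x∈))) ]′ (pending w∈)
      }
      where
      open Config c
      open Simple simple
      open Valid valid
      isLive : ∀ {x y} → y ∈ N x → y ∉ placed x → ⁅ x ⁆ ∈ˡ live
      isLive {x} {y} y∈ y∉ with pending (allBorn x)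
      ... | inj₁ x∈live = x∈live
      ... | inj₂ done   = contradiction (done y y∈) y∉
      u≢v : ⁅ u ⁆ ≢ ⁅ v ⁆
      u≢v eq = N-irrefl (subst (_∈ N u) (sym (x∈⁅y⁆⇒x≡y v (subst (u ∈_) eq (x∈⁅x⁆ u)))) v∈N)
      edges : ∀ x y → x ∈ ⁅ u ⁆ → y ∈ ⁅ v ⁆ → y ∈ N x
      edges x y x∈ y∈ with x∈⁅y⁆⇒x≡y u x∈ | x∈⁅y⁆⇒x≡y v y∈
      ... | refl | refl = v∈N
      legal : Legal G c (block ⁅ u ⁆ ⁅ v ⁆)
      legal = isLive v∈N v∉ , isLive (N-sym v∈N) (v∉ ∘ placed-sym) , u≢v , edges
            , u , v , x∈⁅x⁆ u , x∈⁅x⁆ v , v∉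

    close-next : ∀ {c} X → X ∈ˡ Config.live c →
                 (∀ u v → v ∈ N u → v ∈ Config.placed c u) → Simple c → NextMove c
    close-next {c} X X∈ allPlaced simple = close X , legal , record
      { valid     = apply-Valid G (close X) valid legal
      ; singleton = singleton ∘ proj₁ ∘ ∈-without⁻ {L = live} {X}
      ; pending   = λ {u} _ → inj₂ (allPlaced u)
      }
      where
      open Config c
      open Simple simple
      legal : Legal G c (close X)
      legal = X∈ , λ u v _ → allPlaced u v

  next : ∀ c → Simple c → Finished G c ⊎ NextMove c
  next c simple with Fin.any? (λ v → ¬? (v ∈? Config.born c))
  ... | yes (v , v∉) = inj₂ (birth-next v v∉ simple)
  ... | no noUnborn with Fin.any? (λ u → Fin.any? λ v → v ∈? N u ×-dec ¬? (v ∈? Config.placed c u))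
  ...   | yes (u , v , v∈N , v∉) = inj₂ (block-next u v v∈N v∉ allBorn simple)
    where
    allBorn : ∀ w → w ∈ Config.born c
    allBorn w = decidable-stable (w ∈? Config.born c) λ w∉ → noUnborn (w , w∉)
  ...   | no noUnplaced = closeAll (Config.live c) refl
    where
    allBorn : ∀ w → w ∈ Config.born c
    allBorn w = decidable-stable (w ∈? Config.born c) λ w∉ → noUnborn (w , w∉)
    allPlaced : ∀ u v → v ∈ N u → v ∈ Config.placed c u
    allPlaced u v v∈N =
      decidable-stable (v ∈? Config.placed c u) λ v∉ → noUnplaced (u , v , v∈N , v∉)
    closeAll : ∀ L → L ≡ Config.live c → Finished G c ⊎ NextMove c
    closeAll []      eq = inj₁ (allBorn , allPlaced , sym eq)
    closeAll (X ∷ L) eq = inj₂ (close-next X (subst (X ∈ˡ_) eq (here refl)) allPlaced simple)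

  finish : ∀ c → Acc _<_ (potential c) → Simple c → ∃ (FinishableFrom G c)
  finish c (acc rs) simple with next c simple
  ... | inj₁ fin = 0 , c , [] , fin , refl
  ... | inj₂ (m , legal , simple′)
    with finish (apply G c m) (rs (apply-potential G m legal)) simple′
  ...   | _ , d , p , fin , _ = width G (legal ∷ p) , d , legal ∷ p , fin , refl

lsfwMinimum : ∀ G → Minimum (IsPlayWidth G)
lsfwMinimum G = minimum (finishable? G initial (<-wellFounded _)) (proj₁ k) (proj₂ k)
  where
  k : ∃ (IsPlayWidth G)
  k = finish G initial (<-wellFounded _) (initial-Simple G)

lsfw : Graph → ℕ
lsfw G = Minimum.value (lsfwMinimum G)

{-# OPTIONS --safe #-}
module Submission where

open import Defs
open import Data.Fin using (Fin; zero; suc; toℕ; fromℕ<; cast)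
import Data.Fin.Properties as Fin
open import Data.Fin.Permutation as Perm using (_⟨$⟩ʳ_; _⟨$⟩ˡ_)
open import Data.Fin.Subset
  using (Subset; _∈_; _∉_; _⊆_; _∩_; _∪_; ∁; ⁅_⁆; Nonempty) renaming (⊥ to ∅)
open import Data.Fin.Subset.Properties
  using (_∈?_; nonempty?; x∈p∩q⁺; x∈p∩q⁻; x∈p∪q⁺; x∈p∪q⁻; ∉⊥; x∈⁅x⁆; x∈⁅y⁆⇒x≡y; x∈∁p⇒x∉p;
         x∉p⇒x∈∁p; ⊆-antisym)
open import Data.List using (List; []; _∷_; _++_; length; lookup; map; filter; take; upTo; allFin)
open import Data.List.Extrema.Nat using (xs≤max; argmax-all)
open import Data.List.Membership.Propositional using (find; lose) renaming (_∈_ to _∈ˡ_)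
open import Data.List.Membership.Propositional.Properties
  using (∈-filter⁺; ∈-filter⁻; ∈-allFin; ∈-map⁺; ∈-map⁻; ∈-++⁺ˡ; ∈-++⁺ʳ; ∈-++⁻; ∈-lookup; ∈-upTo⁺;
         ∈-deduplicate⁺; ∈-deduplicate⁻)
open import Data.List.Properties using (length-tabulate)
open import Data.List.Relation.Unary.All as All using (All; []; _∷_)
import Data.List.Relation.Unary.All.Properties as All
open import Data.List.Relation.Unary.AllPairs using (AllPairs; []; _∷_)
open import Data.List.Relation.Unary.Any as Any using (Any; here; there; index)
open import Data.List.Relation.Unary.Any.Properties using (lookup-index)
open import Data.List.Relation.Unary.Unique.DecPropositional.Properties using (deduplicate-!)
open import Data.List.Relation.Unary.Unique.Propositional using (Unique)
import Data.List.Relation.Unary.Unique.Propositional.Properties as Unique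
open import Data.Nat using (ℕ; zero; suc; _+_; _*_; _∸_; _≤_; _<_; z≤n; s≤s; _<?_)
open import Data.Nat.Induction using (<-wellFounded)
import Data.Nat.Properties as ℕ
open import Data.Product using (∃; ∃₂; _×_; _,_; proj₁; proj₂)
open import Data.Sum using (_⊎_; inj₁; inj₂; [_,_]′)
open import Function using (_∘_; id; _⇔_; mk⇔; Equivalence)
open import Induction.WellFounded using (Acc; acc)
open import Relation.Binary.PropositionalEquality
  using (_≡_; _≢_; refl; sym; trans; cong; subst; ≢-sym)
open import Relation.Nullary using (Dec; yes; no; ¬_; ¬?; contradiction)
open import Relation.Nullary.Decidable using (_×-dec_; decidable-stable)

-- Lower bound: vertices sharing a live cable have the same unplaced neighbours, so against any
-- set of vertices between two consecutive births every nonzero row is the row of a live cable.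
-- Ordering the vertices by birth therefore gives a layout with at most as many rows as there are
-- live cables; the cable being born is paid for by the next move, or disappears in it.
-- Upper bound: following a layout, keep one cable per nonzero row.  A new vertex is born as a
-- cable, joined by blocks to the cables whose row contains it, and then cables with empty row
-- are closed and cables with equal rows are folded.

-- Lists without repetitions

lookup-injective : ∀ {A : Set} {xs : List A} → Unique xs →
                   ∀ {i j} → lookup xs i ≡ lookup xs j → i ≡ j
lookup-injective (_  ∷ _)  {zero}  {zero}  _  = refl
lookup-injective (x≢ ∷ _)  {zero}  {suc j} eq = contradiction eq (All.lookup x≢ (∈-lookup j))
lookup-injective (x≢ ∷ _)  {suc i} {zero}  eq = contradiction (sym eq) (All.lookup x≢ (∈-lookup i))
lookup-injective (_  ∷ xs) {suc i} {suc j} eq = cong suc (lookup-injective xs eq)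

-- Sending a position in `xs` to the position of a related element of `ys` is an injection between
-- finite index sets. A relation is used because rows and cables are matched through some vertex, in
-- one direction for each bound.
length-≤-of-injective :
  ∀ {A B : Set} {R : A → B → Set} {xs ys} → Unique xs →
  (∀ {x x′ y} → x ∈ˡ xs → x′ ∈ˡ xs → R x y → R x′ y → x ≡ x′) →
  (∀ {x} → x ∈ˡ xs → Any (R x) ys) → length xs ≤ length ys
length-≤-of-injective {R = R} {xs} {ys} xs! injective total =
  Fin.injective⇒≤ {f = λ i → index (total (∈-lookup i))} λ {i} {j} eq →
    lookup-injective xs! (injective (∈-lookup i) (∈-lookup j)
      (lookup-index (total (∈-lookup i)))
      (subst (R _ ∘ lookup ys) (sym eq) (lookup-index (total (∈-lookup j)))))

Unique-⊆⇒length≤ : ∀ {A : Set} {xs ys : List A} → Unique xs → (∀ {x} → x ∈ˡ xs → x ∈ˡ ys) →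
                   length xs ≤ length ys
Unique-⊆⇒length≤ xs! = length-≤-of-injective xs! (λ _ _ x≡y x′≡y → trans x≡y (sym x′≡y))

-- For cuts of the order of birth: a cut falls inside the vertices of the next birth or beyond them.
take-++-cases : ∀ {A : Set} i (xs ys : List A) →
                (∀ {x} → x ∈ˡ take i (xs ++ ys) → x ∈ˡ xs) ⊎
                (∃ λ j → take i (xs ++ ys) ≡ xs ++ take j ys)
take-++-cases i       []       ys = inj₂ (i , refl)
take-++-cases zero    (x ∷ xs) ys = inj₁ λ ()
take-++-cases (suc i) (x ∷ xs) ys with take-++-cases i xs ys
... | inj₁ ⊆xs      = inj₁ λ { (here refl) → here refl ; (there x∈) → there (⊆xs x∈) }
... | inj₂ (j , eq) = inj₂ (j , cong (x ∷_) eq)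

index<⇒∈take : ∀ {A : Set} i {xs : List A} {x} (x∈ : x ∈ˡ xs) → toℕ (index x∈) < i → x ∈ˡ take i xs
index<⇒∈take (suc i) (here refl) _         = here refl
index<⇒∈take (suc i) (there x∈)  (s≤s x<i) = there (index<⇒∈take i x∈ x<i)

∈take⇒index< : ∀ {A : Set} i {xs : List A} {x} → Unique xs → (x∈ : x ∈ˡ xs) →
               x ∈ˡ take i xs → toℕ (index x∈) < i
∈take⇒index< (suc i) _         (here refl) _           = s≤s z≤n
∈take⇒index< (suc i) (x≢ ∷ _)  (there x∈)  (here refl) = contradiction refl (All.lookup x≢ x∈)
∈take⇒index< (suc i) (_ ∷ xs!) (there x∈)  (there x∈′) = s≤s (∈take⇒index< i xs! x∈ x∈′)

-- A nonempty set is not disjoint from itself.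
disjoint⇒Unique : ∀ {n} {L : List (Subset n)} → All Nonempty L → AllPairs Disjoint L → Unique L
disjoint⇒Unique []               []       = []
disjoint⇒Unique ((v , v∈) ∷ ne) (d ∷ ds) =
  All.map (λ { disj refl → disj (v , x∈p∩q⁺ (v∈ , v∈)) }) d ∷ disjoint⇒Unique ne ds

elements : ∀ {n} → Subset n → List (Fin n)
elements S = filter (_∈? S) (allFin _)

∈-elements⁺ : ∀ {n} {S : Subset n} {v} → v ∈ S → v ∈ˡ elements S
∈-elements⁺ {S = S} {v} = ∈-filter⁺ (_∈? S) (∈-allFin v)

∈-elements⁻ : ∀ {n} {S : Subset n} {v} → v ∈ˡ elements S → v ∈ S
∈-elements⁻ {n} {S} v∈ = proj₂ (∈-filter⁻ (_∈? S) {xs = allFin n} v∈)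

-- Layouts and plays

module _ (G : Graph) where
  open Graph G

  -- Lookup in `L` and position in `L` are mutually inverse once `L` and `allFin order` are known to
  -- have equal length. Only the prefixes of the resulting layout matter later.
  listLayout : (L : List (Fin order)) → Unique L → (∀ v → v ∈ˡ L) →
               ∃ λ (π : Layout G) → ∀ i v → v ∈ prefix G π i ⇔ v ∈ˡ take i L
  listLayout L L! v∈L = π , λ i v → mk⇔
    (λ v∈ → index<⇒∈take i (v∈L v) (subst (_< i) (position v) (∈⟪⟫⁻ (before? i) v∈)))
    (λ v∈ → ∈⟪⟫⁺ (before? i) (subst (_< i) (sym (position v)) (∈take⇒index< i L! (v∈L v) v∈)))
    where
    |L| : length L ≡ order
    |L| = ℕ.≤-antisym
      (subst (length L ≤_) (length-tabulate id) (Unique-⊆⇒length≤ L! (λ {v} _ → ∈-allFin v)))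
      (subst (_≤ length L) (length-tabulate id)
        (Unique-⊆⇒length≤ (Unique.allFin⁺ order) (λ {v} _ → v∈L v)))
    vertex : Fin order → Fin order
    vertex = lookup L ∘ cast (sym |L|)
    rank : Fin order → Fin order
    rank = cast |L| ∘ index ∘ v∈L
    π : Layout G
    π = Perm.permutation vertex rank
      (λ v → trans (cong (lookup L) (Fin.cast-involutive (sym |L|) |L| _))
                   (sym (lookup-index (v∈L v))))
      (λ i → trans (cong (cast |L|) (lookup-injective L! (sym (lookup-index (v∈L (vertex i))))))
                   (Fin.cast-involutive |L| (sym |L|) i))
    before? : ∀ i v → Dec (toℕ (π ⟨$⟩ˡ v) < i)
    before? i v = toℕ (π ⟨$⟩ˡ v) <? i
    position : ∀ v → toℕ (π ⟨$⟩ˡ v) ≡ toℕ (index (v∈L v))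
    position v = Fin.toℕ-cast |L| (index (v∈L v))

  ∈-row⁺ : ∀ {P u w} → w ∈ N u → w ∉ P → w ∈ N u ∩ ∁ P
  ∈-row⁺ w∈N w∉P = x∈p∩q⁺ (w∈N , x∉p⇒x∈∁p w∉P)

  ∈-row⁻ : ∀ {P} u {w} → w ∈ N u ∩ ∁ P → w ∈ N u × w ∉ P
  ∈-row⁻ u w∈ with x∈p∩q⁻ (N u) _ w∈
  ... | w∈N , w∈∁P = w∈N , x∈∁p⇒x∉p w∈∁P

  -- The set `P` is arbitrary, so that the lower bound can follow a play without carrying a layout
  -- along.
  record ActiveRow (P R : Subset order) : Set where
    constructor activeRow
    field
      {source} : Fin order
      source∈  : source ∈ P
      R≡       : R ≡ N source ∩ ∁ P
      nonempty : Nonempty R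

  ∈-activeRows⁺ : ∀ {π i R} → ActiveRow (prefix G π i) R → R ∈ˡ activeRows G π i
  ∈-activeRows⁺ {π} {i} (activeRow {u} u∈ refl R≢∅) =
    ∈-deduplicate⁺ _≟ˢ_ (∈-filter⁺ nonempty? (∈-map⁺ (row G π i) (∈-elements⁺ u∈)) R≢∅)

  ∈-activeRows⁻ : ∀ {π i R} → R ∈ˡ activeRows G π i → ActiveRow (prefix G π i) R
  ∈-activeRows⁻ {π} {i} R∈
    with ∈-filter⁻ nonempty? {xs = map (row G π i) (elements (prefix G π i))}
           (∈-deduplicate⁻ _≟ˢ_ _ R∈)
  ... | R∈map , R≢∅ with ∈-map⁻ (row G π i) R∈map
  ...   | u , u∈ , R≡ = activeRow (∈-elements⁻ u∈) R≡ R≢∅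

  -- Invariants of arbitrary plays

  sameCable : ∀ {c} → Valid G c → ∀ {X Y v} → X ∈ˡ Config.live c → Y ∈ˡ Config.live c →
              v ∈ X → v ∈ Y → X ≡ Y
  sameCable val {X} {Y} {v} X∈ Y∈ v∈X v∈Y = decidable-stable (X ≟ˢ Y) λ X≢Y →
    AllPairs-Disjoint (Valid.live-disjoint val) X∈ Y∈ X≢Y (v , x∈p∩q⁺ (v∈X , v∈Y))

  placed-mono : ∀ c m {u} → Config.placed c u ⊆ Config.placed (apply G c m) u
  placed-mono c (birth S)   = id
  placed-mono c (fold X Y)  = id
  placed-mono c (block X Y) = x∈p∪q⁺ ∘ inj₁
  placed-mono c (clique X)  = x∈p∪q⁺ ∘ inj₁
  placed-mono c (close X)   = id

  -- A cable is lost only to a fold, which keeps its vertices together in a larger cable, or to a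
  -- close, whose legality is the second alternative.
  survives : ∀ {c} m → Legal G c m → ∀ {Z} → Z ∈ˡ Config.live c →
             (∃ λ Z′ → Z′ ∈ˡ Config.live (apply G c m) × Z ⊆ Z′) ⊎
             (∀ u v → u ∈ Z → v ∈ N u → v ∈ Config.placed c u)
  survives (birth S) _ Z∈ = inj₁ (_ , there Z∈ , id)
  survives {c} (fold X Y) _ {Z} Z∈ with Z ≟ˢ X | Z ≟ˢ Y
  ... | yes refl | _        = inj₁ (_ , here refl , x∈p∪q⁺ ∘ inj₁)
  ... | no _     | yes refl = inj₁ (_ , here refl , x∈p∪q⁺ ∘ inj₂)
  ... | no Z≢X   | no Z≢Y   = inj₁ (_ , there (∈-without⁺ (∈-without⁺ Z∈ Z≢X) Z≢Y) , id)
  survives (block X Y) _ Z∈ = inj₁ (_ , Z∈ , id)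
  survives (clique X)  _ Z∈ = inj₁ (_ , Z∈ , id)
  survives (close X) (_ , allPlaced) {Z} Z∈ with Z ≟ˢ X
  ... | yes refl = inj₂ allPlaced
  ... | no Z≢X   = inj₁ (_ , ∈-without⁺ Z∈ Z≢X , id)

  -- Invariants beyond `Valid` that serve both bounds. `pending` persists because a vertex leaves
  -- the live cables only by a close, hence after all its edges are placed.
  record Sound (c : Config order) : Set where
    open Config c
    field
      valid       : Valid G c
      placed-born : ∀ {u v} → v ∈ placed u → v ∈ born
      pending     : ∀ {u v} → u ∈ born → v ∈ N u → v ∉ placed u → ∃ λ X → X ∈ˡ live × u ∈ X

  initial-Sound : Sound initial
  initial-Sound = record
    { valid       = initial-Valid G
    ; placed-born = λ v∈∅ → contradiction v∈∅ ∉⊥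
    ; pending     = λ u∈∅ → contradiction u∈∅ ∉⊥
    }

  apply-Sound : ∀ {c} m → Legal G c m → Sound c → Sound (apply G c m)
  apply-Sound {c} m legal sound = record
    { valid       = apply-Valid G m valid legal
    ; placed-born = placed-born′ m legal
    ; pending     = λ u∈ v∈N v∉ → pending′ m legal u∈ v∈N (v∉ ∘ placed-mono c m)
    }
    where
    open Config c
    open Sound sound
    open Valid valid
    placed-born′ : ∀ m → Legal G c m → ∀ {u v} → v ∈ Config.placed (apply G c m) u →
                   v ∈ Config.born (apply G c m)
    placed-born′ (birth S)  _ = x∈p∪q⁺ ∘ inj₁ ∘ placed-born
    placed-born′ (fold X Y) _ = placed-born
    placed-born′ (block X Y) (X∈ , Y∈ , _) {u} v∈ with x∈p∪q⁻ (placed u) _ v∈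
    ... | inj₁ v∈placed = placed-born v∈placed
    ... | inj₂ v∈new with ∈⟪⟫⁻ (across? G X Y u) (proj₂ (x∈p∩q⁻ (N u) _ v∈new))
    ...   | inj₁ (_ , v∈Y) = All.lookup live-born Y∈ v∈Y
    ...   | inj₂ (_ , v∈X) = All.lookup live-born X∈ v∈X
    placed-born′ (clique X) (X∈ , _) {u} v∈ with x∈p∪q⁻ (placed u) _ v∈
    ... | inj₁ v∈placed = placed-born v∈placed
    ... | inj₂ v∈new =
      All.lookup live-born X∈ (proj₂ (∈⟪⟫⁻ (within? G X u) (proj₂ (x∈p∩q⁻ (N u) _ v∈new))))
    placed-born′ (close X) _ = placed-born

    kept : ∀ m → Legal G c m → ∀ {u v} → u ∈ born → v ∈ N u → v ∉ placed u →
           ∃ λ X → X ∈ˡ Config.live (apply G c m) × u ∈ X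
    kept m legal u∈ v∈N v∉ with pending u∈ v∈N v∉
    ... | X , X∈ , u∈X with survives m legal X∈
    ...   | inj₁ (X′ , X′∈ , X⊆X′) = X′ , X′∈ , X⊆X′ u∈X
    ...   | inj₂ allPlaced         = contradiction (allPlaced _ _ u∈X v∈N) v∉

    pending′ : ∀ m → Legal G c m → ∀ {u v} → u ∈ Config.born (apply G c m) → v ∈ N u → v ∉ placed u →
               ∃ λ X → X ∈ˡ Config.live (apply G c m) × u ∈ X
    pending′ (birth S) legal u∈ v∈N v∉ with x∈p∪q⁻ born S u∈
    ... | inj₁ u∈born = kept (birth S) legal u∈born v∈N v∉
    ... | inj₂ u∈S    = S , here refl , u∈S
    pending′ m@(fold _ _)  = kept m
    pending′ m@(block _ _) = kept m
    pending′ m@(clique _)  = kept m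
    pending′ m@(close _)   = kept m

  -- The lower bound

  -- The move that places uw is a block or a clique involving the cable of `u`, and its legality
  -- applies to `v` as well. In a clique `w` lies in that cable too, hence the condition `w ≢ v`.
  placed-twin : ∀ {c} → Valid G c → ∀ m → Legal G c m → ∀ {Z u v w} → Z ∈ˡ Config.live c →
                u ∈ Z → v ∈ Z → w ≢ v → w ∉ Config.placed c u →
                w ∈ Config.placed (apply G c m) u → w ∈ N v
  placed-twin val (birth S)  _ _ _ _ _ w∉ w∈ = contradiction w∈ w∉
  placed-twin val (fold X Y) _ _ _ _ _ w∉ w∈ = contradiction w∈ w∉
  placed-twin val (close X)  _ _ _ _ _ w∉ w∈ = contradiction w∈ w∉
  placed-twin {c} val (block X Y) (X∈ , Y∈ , _ , edges , _) {u = u} {v} {w} Z∈ u∈Z v∈Z _ w∉ w∈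
    with x∈p∪q⁻ (Config.placed c u) _ w∈
  ... | inj₁ w∈placed = contradiction w∈placed w∉
  ... | inj₂ w∈new with ∈⟪⟫⁻ (across? G X Y u) (proj₂ (x∈p∩q⁻ (N u) _ w∈new))
  ...   | inj₁ (u∈X , w∈Y) = edges v w (subst (v ∈_) (sameCable val Z∈ X∈ u∈Z u∈X) v∈Z) w∈Y
  ...   | inj₂ (u∈Y , w∈X) =
    N-sym (edges w v w∈X (subst (v ∈_) (sameCable val Z∈ Y∈ u∈Z u∈Y) v∈Z))
  placed-twin {c} val (clique X) (X∈ , edges , _) {u = u} {v} {w} Z∈ u∈Z v∈Z w≢v w∉ w∈
    with x∈p∪q⁻ (Config.placed c u) _ w∈
  ... | inj₁ w∈placed = contradiction w∈placed w∉
  ... | inj₂ w∈new with ∈⟪⟫⁻ (within? G X u) (proj₂ (x∈p∩q⁻ (N u) _ w∈new))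
  ...   | u∈X , w∈X =
    edges v w (subst (v ∈_) (sameCable val Z∈ X∈ u∈Z u∈X) v∈Z) w∈X (≢-sym w≢v)

  -- The edge uw is placed by a later block or clique, and by then the cable of u contains v.
  unplaced-twin : ∀ {c d} → Valid G c → Play G c d → Finished G d →
                  ∀ {Z u v w} → Z ∈ˡ Config.live c → u ∈ Z → v ∈ Z → w ≢ v →
                  w ∈ N u → w ∉ Config.placed c u → w ∈ N v
  unplaced-twin val [] (_ , allPlaced , _) _ _ _ _ w∈N w∉ = contradiction (allPlaced _ _ w∈N) w∉
  unplaced-twin {c} val (_∷_ {m = m} legal p) fin {u = u} {w = w} Z∈ u∈Z v∈Z w≢v w∈N w∉
    with w ∈? Config.placed (apply G c m) u | survives m legal Z∈
  ... | yes w∈ | _ = placed-twin val m legal Z∈ u∈Z v∈Z w≢v w∉ w∈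
  ... | no w∉′ | inj₁ (Z′ , Z′∈ , Z⊆Z′) =
    unplaced-twin (apply-Valid G m val legal) p fin Z′∈ (Z⊆Z′ u∈Z) (Z⊆Z′ v∈Z) w≢v w∈N w∉′
  ... | no _   | inj₂ allPlaced = contradiction (allPlaced _ _ u∈Z w∈N) w∉

  -- The source of a nonzero row has an unplaced edge leaving `P`, so it lies in a live cable; by
  -- `unplaced-twin`, sources in one cable have equal rows. The hypotheses on `P` let it cut through
  -- the vertices of the latest birth.
  length-rows≤ℓ : ∀ {c d} → Sound c → Play G c d → Finished G d →
                  ∀ {P Rs} → P ⊆ Config.born c → (∀ {u w} → w ∈ Config.placed c u → w ∈ P) →
                  Unique Rs → (∀ {R} → R ∈ˡ Rs → ActiveRow P R) → length Rs ≤ Config.ℓ c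
  length-rows≤ℓ {c} sound p fin {P} {Rs} P⊆ placed⊆ Rs! rows = length-≤-of-injective Rs! injective total
    where
    open Config c
    open Sound sound
    -- The cable `X` may straddle the cut, so the source is required to lie in `P`.
    RowOf : Subset order → Subset order → Set
    RowOf R X = ∃ λ u → u ∈ X × u ∈ P × R ≡ N u ∩ ∁ P
    row-⊆ : ∀ {X u v} → X ∈ˡ live → u ∈ X → v ∈ X → v ∈ P → N u ∩ ∁ P ⊆ N v ∩ ∁ P
    row-⊆ {u = u} X∈ u∈X v∈X v∈P w∈ with ∈-row⁻ u w∈
    -- `P` contains `v` and all ends of placed edges but not `w`; so `w` differs from `v`, and uw is
    -- unplaced.
    ... | w∈N , w∉P = ∈-row⁺ (unplaced-twin valid p fin X∈ u∈X v∈X (λ { refl → w∉P v∈P }) w∈N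
                                            (w∉P ∘ placed⊆)) w∉P
    cableOf : ∀ {R} → R ∈ˡ Rs → ∃ λ X → X ∈ˡ live × RowOf R X
    cableOf R∈ with rows R∈
    ... | activeRow {u} u∈P R≡ (w , w∈R) with ∈-row⁻ u (subst (w ∈_) R≡ w∈R)
    ...   | w∈N , w∉P with pending (P⊆ u∈P) w∈N (w∉P ∘ placed⊆)
    ...     | X , X∈ , u∈X = X , X∈ , u , u∈X , u∈P , R≡
    injective : ∀ {R R′ X} → R ∈ˡ Rs → R′ ∈ˡ Rs →
                X ∈ˡ live × RowOf R X → X ∈ˡ live × RowOf R′ X → R ≡ R′
    injective _ _ (X∈ , u , u∈X , u∈P , R≡) (_ , v , v∈X , v∈P , R′≡) =
      trans R≡ (trans (⊆-antisym (row-⊆ X∈ u∈X v∈X v∈P) (row-⊆ X∈ v∈X u∈X u∈P)) (sym R′≡))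
    total : ∀ {R} → R ∈ˡ Rs → Any (λ X → X ∈ˡ live × RowOf R X) live
    total R∈ with cableOf R∈
    ... | X , X∈ , rowOf = lose X∈ (X∈ , rowOf)

  -- Compares the cost of a fold or close with the number `m` of cables that remain after it.
  m<n⇒2m≤2n∸1 : ∀ {m n} → m < n → 2 * m ≤ 2 * n ∸ 1
  m<n⇒2m≤2n∸1 {m} {n} m<n = ℕ.<⇒≤pred (ℕ.*-monoʳ-< 2 m<n)

  length-fold : ∀ {c : Config order} {X Y} → X ∈ˡ Config.live c → Y ∈ˡ Config.live c → X ≢ Y →
                length (Config.live (apply G c (fold X Y))) < Config.ℓ c
  length-fold X∈ Y∈ X≢Y =
    ℕ.≤-<-trans (length-without (∈-without⁺ Y∈ (≢-sym X≢Y))) (length-without X∈)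

  -- A birth is followed by a move that costs at least twice the number of live cables, or by
  -- a fold or close, after which the cables still represent all nonzero rows against P.
  2*length-rows≤width : ∀ {c d} → Sound c → (p : Play G c d) → Finished G d →
                        ∀ {P Rs} → Config.live c ≢ [] →
                        P ⊆ Config.born c → (∀ {u w} → w ∈ Config.placed c u → w ∈ P) →
                        Unique Rs → (∀ {R} → R ∈ˡ Rs → ActiveRow P R) → 2 * length Rs ≤ width G p
  -- The play cannot stop while the newborn cable is live.
  2*length-rows≤width sound [] (_ , _ , none) live≢[] _ _ _ _ = contradiction none live≢[]
  2*length-rows≤width {c} sound q@(_∷_ {m = m} legal p) fin {P} {Rs} _ P⊆ placed⊆ Rs! rows =
    ℕ.≤-trans (bound m legal p) (ℕ.m≤m⊔n (cost c m) (width G p))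
    where
    now : 2 * length Rs ≤ 2 * Config.ℓ c
    now = ℕ.*-monoʳ-≤ 2 (length-rows≤ℓ sound q fin P⊆ placed⊆ Rs! rows)
    bound : ∀ m (legal : Legal G c m) → Play G (apply G c m) _ → 2 * length Rs ≤ cost c m
    bound (birth S)   _ _ = ℕ.≤-trans now (ℕ.m≤m+n _ 1)
    bound (block X Y) _ _ = now
    bound (clique X)  _ _ = now
    bound m@(fold X Y) legal@(X∈ , Y∈ , X≢Y) p = ℕ.≤-trans
      (ℕ.*-monoʳ-≤ 2 (length-rows≤ℓ (apply-Sound m legal sound) p fin P⊆ placed⊆ Rs! rows))
      (m<n⇒2m≤2n∸1 (length-fold {c = c} X∈ Y∈ X≢Y))
    bound m@(close X) legal@(X∈ , _) p = ℕ.≤-trans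
      (ℕ.*-monoʳ-≤ 2 (length-rows≤ℓ (apply-Sound m legal sound) p fin P⊆ placed⊆ Rs! rows))
      (m<n⇒2m≤2n∸1 (length-without X∈))

  -- The layout by order of birth

  births : ∀ {c d} → Play G c d → List (Fin order)
  births []                          = []
  births (_∷_ {m = birth S}   _ p)   = elements S ++ births p
  births (_∷_ {m = fold _ _}  _ p)   = births p
  births (_∷_ {m = block _ _} _ p)   = births p
  births (_∷_ {m = clique _}  _ p)   = births p
  births (_∷_ {m = close _}   _ p)   = births p

  births-fresh : ∀ {c d} (p : Play G c d) {v} → v ∈ˡ births p → v ∉ Config.born c
  births-fresh {c} (_∷_ {m = birth S} (_ , S∩born) p) v∈ v∈born with ∈-++⁻ (elements S) v∈
  ... | inj₁ v∈S = S∩born (_ , x∈p∩q⁺ (∈-elements⁻ v∈S , v∈born))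
  ... | inj₂ v∈p = births-fresh p v∈p (x∈p∪q⁺ (inj₁ v∈born))
  births-fresh (_∷_ {m = fold _ _}  _ p) = births-fresh p
  births-fresh (_∷_ {m = block _ _} _ p) = births-fresh p
  births-fresh (_∷_ {m = clique _}  _ p) = births-fresh p
  births-fresh (_∷_ {m = close _}   _ p) = births-fresh p

  births-! : ∀ {c d} (p : Play G c d) → Unique (births p)
  births-! [] = []
  births-! (_∷_ {m = birth S} _ p) =
    Unique.++⁺ (Unique.filter⁺ (_∈? S) (Unique.allFin⁺ order)) (births-! p) λ (v∈S , v∈p) →
      births-fresh p v∈p (x∈p∪q⁺ (inj₂ (∈-elements⁻ v∈S)))
  births-! (_∷_ {m = fold _ _}  _ p) = births-! p
  births-! (_∷_ {m = block _ _} _ p) = births-! p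
  births-! (_∷_ {m = clique _}  _ p) = births-! p
  births-! (_∷_ {m = close _}   _ p) = births-! p

  births-complete : ∀ {c d} (p : Play G c d) → Finished G d → ∀ v → v ∈ Config.born c ⊎ v ∈ˡ births p
  births-complete [] (allBorn , _) v = inj₁ (allBorn v)
  births-complete {c} (_∷_ {m = birth S} _ p) fin v with births-complete p fin v
  ... | inj₂ v∈p = inj₂ (∈-++⁺ʳ (elements S) v∈p)
  ... | inj₁ v∈  with x∈p∪q⁻ (Config.born c) S v∈
  ...   | inj₁ v∈born = inj₁ v∈born
  ...   | inj₂ v∈S    = inj₂ (∈-++⁺ˡ (∈-elements⁺ v∈S))
  births-complete (_∷_ {m = fold _ _}  _ p) = births-complete p
  births-complete (_∷_ {m = block _ _} _ p) = births-complete p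
  births-complete (_∷_ {m = clique _}  _ p) = births-complete p
  births-complete (_∷_ {m = close _}   _ p) = births-complete p

  -- Induction on the play with `P` fixed: `i` counts the vertices of `P` still to be born and
  -- shrinks with every birth that the cut passes. At the birth where the cut falls,
  -- `2*length-rows≤width` takes over.
  cut-bound : ∀ {c d} → Sound c → (p : Play G c d) → Finished G d → ∀ i {P} →
              (∀ v → v ∈ P ⇔ (v ∈ Config.born c ⊎ v ∈ˡ take i (births p))) →
              ∀ {Rs} → Unique Rs → (∀ {R} → R ∈ˡ Rs → ActiveRow P R) → 2 * length Rs ≤ width G p
  cut-bound _ [] _ _ _ {[]} _ _ = z≤n
  -- At the end of the play every vertex is born, so `P` is everything and no row is nonzero.
  cut-bound _ [] (allBorn , _) _ P⇔ {R ∷ _} _ rows with rows (here refl)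
  ... | activeRow {u} _ R≡ (w , w∈R) = contradiction
    (Equivalence.from (P⇔ w) (inj₁ (allBorn w)))
    (proj₂ (∈-row⁻ u (subst (w ∈_) R≡ w∈R)))
  cut-bound {c} sound q@(_∷_ {m = m@(birth S)} legal p) fin i {P} P⇔ Rs! rows
    with take-++-cases i (elements S) (births p)
  -- The cut falls inside `S`. The birth places no edge, so the ends of placed edges were born
  -- before `S` and lie in `P`.
  ... | inj₁ ⊆S = ℕ.≤-trans
    (2*length-rows≤width (apply-Sound m legal sound) p fin (λ ())
      (λ {v} v∈P → x∈p∪q⁺ ([ inj₁ , inj₂ ∘ ∈-elements⁻ ∘ ⊆S ]′ (Equivalence.to (P⇔ v) v∈P)))
      (λ w∈ → Equivalence.from (P⇔ _) (inj₁ (Sound.placed-born sound w∈)))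
      Rs! rows)
    (ℕ.m≤n⊔m (cost c m) (width G p))
  ... | inj₂ (j , eq) = ℕ.≤-trans
    (cut-bound (apply-Sound m legal sound) p fin j (λ v → mk⇔ to from) Rs! rows)
    (ℕ.m≤n⊔m (cost c m) (width G p))
    where
    to : ∀ {v} → v ∈ P → v ∈ Config.born c ∪ S ⊎ v ∈ˡ take j (births p)
    to {v} v∈P with Equivalence.to (P⇔ v) v∈P
    ... | inj₁ v∈born = inj₁ (x∈p∪q⁺ (inj₁ v∈born))
    ... | inj₂ v∈ with ∈-++⁻ (elements S) (subst (v ∈ˡ_) eq v∈)
    ...   | inj₁ v∈S = inj₁ (x∈p∪q⁺ (inj₂ (∈-elements⁻ v∈S)))
    ...   | inj₂ v∈p = inj₂ v∈p
    from : ∀ {v} → v ∈ Config.born c ∪ S ⊎ v ∈ˡ take j (births p) → v ∈ P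
    from {v} (inj₂ v∈p) =
      Equivalence.from (P⇔ v) (inj₂ (subst (v ∈ˡ_) (sym eq) (∈-++⁺ʳ (elements S) v∈p)))
    from {v} (inj₁ v∈) with x∈p∪q⁻ (Config.born c) S v∈
    ... | inj₁ v∈born = Equivalence.from (P⇔ v) (inj₁ v∈born)
    ... | inj₂ v∈S    =
      Equivalence.from (P⇔ v) (inj₂ (subst (v ∈ˡ_) (sym eq) (∈-++⁺ˡ (∈-elements⁺ v∈S))))
  cut-bound {c} sound (_∷_ {m = m@(fold _ _)}  legal p) fin i P⇔ Rs! rows = ℕ.≤-trans
    (cut-bound (apply-Sound m legal sound) p fin i P⇔ Rs! rows) (ℕ.m≤n⊔m (cost c m) (width G p))
  cut-bound {c} sound (_∷_ {m = m@(block _ _)} legal p) fin i P⇔ Rs! rows = ℕ.≤-trans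
    (cut-bound (apply-Sound m legal sound) p fin i P⇔ Rs! rows) (ℕ.m≤n⊔m (cost c m) (width G p))
  cut-bound {c} sound (_∷_ {m = m@(clique _)}  legal p) fin i P⇔ Rs! rows = ℕ.≤-trans
    (cut-bound (apply-Sound m legal sound) p fin i P⇔ Rs! rows) (ℕ.m≤n⊔m (cost c m) (width G p))
  cut-bound {c} sound (_∷_ {m = m@(close _)}   legal p) fin i P⇔ Rs! rows = ℕ.≤-trans
    (cut-bound (apply-Sound m legal sound) p fin i P⇔ Rs! rows) (ℕ.m≤n⊔m (cost c m) (width G p))

  births-layout : ∀ {d} (p : Play G initial d) → Finished G d →
                  ∃ λ (π : Layout G) → 2 * layoutWidth G π ≤ width G p
  -- The maximum is the default 0 or one of the listed lengths, so bounding each of these suffices.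
  births-layout p fin = π , argmax-all id {P = λ k → 2 * k ≤ width G p} {0} {lengths} z≤n
                              (All.map⁺ (All.universal bound (upTo (suc order))))
    where
    layout = listLayout (births p) (births-! p) λ v →
      [ (λ v∈∅ → contradiction v∈∅ ∉⊥) , id ]′ (births-complete p fin v)
    π = proj₁ layout
    prefix⇔ = proj₂ layout
    lengths : List ℕ
    lengths = map (λ i → length (activeRows G π i)) (upTo (suc order))
    bound : ∀ i → 2 * length (activeRows G π i) ≤ width G p
    bound i = cut-bound initial-Sound p fin i
      (λ v → mk⇔ (inj₂ ∘ Equivalence.to (prefix⇔ i v))
                 [ (λ v∈∅ → contradiction v∈∅ ∉⊥) , Equivalence.from (prefix⇔ i v) ]′)
      (deduplicate-! _≟ˢ_ _) (∈-activeRows⁻ {π} {i})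

-- The upper bound

module Greedy (G : Graph) (π : Layout G) where
  open Graph G

  k : ℕ
  k = layoutWidth G π

  length-activeRows≤k : ∀ {i} → i ≤ order → length (activeRows G π i) ≤ k
  length-activeRows≤k i≤n =
    All.lookup (xs≤max 0 (map (λ i → length (activeRows G π i)) (upTo (suc order))))
               (∈-map⁺ _ (∈-upTo⁺ (s≤s i≤n)))

  prefix-zero : ∅ ≡ prefix G π 0
  prefix-zero = ⊆-antisym (λ v∈∅ → contradiction v∈∅ ∉⊥)
                          (λ v∈ → contradiction (∈⟪⟫⁻ (λ v → toℕ (π ⟨$⟩ˡ v) <? 0) v∈) λ ())

  ∉-prefix : ∀ {i} (i<n : i < order) → π ⟨$⟩ʳ fromℕ< i<n ∉ prefix G π i
  ∉-prefix {i} i<n v∈ = ℕ.<-irrefl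
    (trans (cong toℕ (Perm.inverseˡ π)) (Fin.toℕ-fromℕ< i<n))
    (∈⟪⟫⁻ (λ v → toℕ (π ⟨$⟩ˡ v) <? i) v∈)

  prefix-suc : ∀ {i} (i<n : i < order) →
               prefix G π i ∪ ⁅ π ⟨$⟩ʳ fromℕ< i<n ⁆ ≡ prefix G π (suc i)
  prefix-suc {i} i<n = ⊆-antisym (to ∘ x∈p∪q⁻ (prefix G π i) _) (x∈p∪q⁺ ∘ from)
    where
    vᵢ = π ⟨$⟩ʳ fromℕ< i<n
    before? : ∀ j v → Dec (toℕ (π ⟨$⟩ˡ v) < j)
    before? j v = toℕ (π ⟨$⟩ˡ v) <? j
    to : ∀ {v} → v ∈ prefix G π i ⊎ v ∈ ⁅ vᵢ ⁆ → v ∈ prefix G π (suc i)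
    to (inj₁ v∈) = ∈⟪⟫⁺ (before? (suc i)) (ℕ.m<n⇒m<1+n (∈⟪⟫⁻ (before? i) v∈))
    to (inj₂ v∈) with x∈⁅y⁆⇒x≡y vᵢ v∈
    ... | refl = ∈⟪⟫⁺ (before? (suc i))
      (s≤s (ℕ.≤-reflexive (trans (cong toℕ (Perm.inverseˡ π)) (Fin.toℕ-fromℕ< i<n))))
    from : ∀ {v} → v ∈ prefix G π (suc i) → v ∈ prefix G π i ⊎ v ∈ ⁅ vᵢ ⁆
    from {v} v∈ with ℕ.m<1+n⇒m<n∨m≡n (∈⟪⟫⁻ (before? (suc i)) v∈)
    ... | inj₁ <i = inj₁ (∈⟪⟫⁺ (before? i) <i)
    ... | inj₂ ≡i = inj₂ (subst (_∈ ⁅ vᵢ ⁆) (sym v≡vᵢ) (x∈⁅x⁆ vᵢ))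
      where
      v≡vᵢ : v ≡ vᵢ
      v≡vᵢ = trans (sym (Perm.inverseʳ π))
        (cong (π ⟨$⟩ʳ_) (Fin.toℕ-injective (trans ≡i (sym (Fin.toℕ-fromℕ< i<n)))))

  -- The invariant of the greedy play. The bound `suc k` leaves room for one newborn cable besides
  -- one cable for each nonzero row.
  record Stage (c : Config order) : Set where
    open Config c
    field
      sound : Sound G c
      {i}   : ℕ
      i≤n   : i ≤ order
      born≡ : born ≡ prefix G π i
      -- By N-irrefl, the case w = v says that all edges inside a cable are placed.
      twins : ∀ {Z u v w} → Z ∈ˡ live → u ∈ Z → v ∈ Z → w ∈ N u → w ∉ placed u →
              w ∈ N v × w ∉ placed v
      ℓ≤1+k : ℓ ≤ suc k

  initial-Stage : Stage initial
  initial-Stage = record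
    { sound = initial-Sound G
    ; i≤n   = z≤n
    ; born≡ = prefix-zero
    ; twins = λ ()
    ; ℓ≤1+k = z≤n
    }

  -- Moves that preserve the invariant

  NextStage : Config order → Set
  NextStage c = ∃ λ m → Legal G c m × Stage (apply G c m) × cost c m ≤ 2 * k + 2

  2*ℓ≤ : ∀ {ℓ} → ℓ ≤ suc k → 2 * ℓ ≤ 2 * k + 2
  2*ℓ≤ ℓ≤ = ℕ.≤-trans (ℕ.*-monoʳ-≤ 2 ℓ≤) (ℕ.≤-reflexive (trans (ℕ.*-suc 2 k) (ℕ.+-comm 2 (2 * k))))

  2*ℓ∸1≤ : ∀ {ℓ} → ℓ ≤ suc k → 2 * ℓ ∸ 1 ≤ 2 * k + 2
  2*ℓ∸1≤ {ℓ} ℓ≤ = ℕ.≤-trans (ℕ.m∸n≤m (2 * ℓ) 1) (2*ℓ≤ ℓ≤)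

  -- By `twins`, applied first in the cable of `u` and then in that of `v`, a single unplaced edge
  -- uv makes all pairs between the two cables edges.
  block-next : ∀ {c} → Stage c → ∀ {u v} → u ∈ Config.born c → v ∈ Config.born c →
               v ∈ N u → v ∉ Config.placed c u → NextStage c
  block-next {c} stage {u} {v} u∈born v∈born v∈N v∉
    with Sound.pending (Stage.sound stage) u∈born v∈N v∉
       | Sound.pending (Stage.sound stage) v∈born (N-sym v∈N)
           (v∉ ∘ Valid.placed-sym (Sound.valid (Stage.sound stage)))
  ... | X , X∈ , u∈X | Y , Y∈ , v∈Y = block X Y , legal , record
    { sound = apply-Sound G (block X Y) legal sound
    ; i≤n   = i≤n
    ; born≡ = born≡
    ; twins = twins′
    ; ℓ≤1+k = ℓ≤1+k
    } , 2*ℓ≤ ℓ≤1+k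
    where
    open Config c
    open Stage stage
    open Sound sound
    open Valid valid
    X≢Y : X ≢ Y
    X≢Y refl = N-irrefl (proj₁ (twins X∈ u∈X v∈Y v∈N v∉))
    edges : ∀ x y → x ∈ X → y ∈ Y → y ∈ N x
    edges x y x∈ y∈ with twins X∈ u∈X x∈ v∈N v∉
    ... | v∈Nx , v∉x = N-sym (proj₁ (twins Y∈ v∈Y y∈ (N-sym v∈Nx) (v∉x ∘ placed-sym)))
    legal : Legal G c (block X Y)
    legal = X∈ , Y∈ , X≢Y , edges , u , v , u∈X , v∈Y , v∉
    twins′ : ∀ {Z x y w} → Z ∈ˡ live → x ∈ Z → y ∈ Z → w ∈ N x →
             w ∉ Config.placed (apply G c (block X Y)) x →
             w ∈ N y × w ∉ Config.placed (apply G c (block X Y)) y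
    twins′ {Z} {x} {y} {w} Z∈ x∈Z y∈Z w∈N w∉
      with twins Z∈ x∈Z y∈Z w∈N (w∉ ∘ placed-mono G c (block X Y))
    ... | w∈Ny , w∉y = w∈Ny , [ w∉y , w∉ ∘ new ]′ ∘ x∈p∪q⁻ (placed y) _
      where
      -- Live cables are disjoint, so `x` is on the same side of the block as `y`, and the block
      -- treats `w` alike for both.
      moved : ∀ {X} → X ∈ˡ live → y ∈ X → x ∈ X
      moved X∈ y∈X = subst (x ∈_) (sameCable G valid Z∈ X∈ y∈Z y∈X) x∈Z
      acrossx : w ∈ ⟪ across? G X Y y ⟫ → w ∈ ⟪ across? G X Y x ⟫
      acrossx w∈ with ∈⟪⟫⁻ (across? G X Y y) w∈
      ... | inj₁ (y∈X , w∈Y) = ∈⟪⟫⁺ (across? G X Y x) (inj₁ (moved X∈ y∈X , w∈Y))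
      ... | inj₂ (y∈Y , w∈X) = ∈⟪⟫⁺ (across? G X Y x) (inj₂ (moved Y∈ y∈Y , w∈X))
      new : w ∈ N y ∩ ⟪ across? G X Y y ⟫ → w ∈ Config.placed (apply G c (block X Y)) x
      new w∈ = x∈p∪q⁺ (inj₂ (x∈p∩q⁺ (w∈N , acrossx (proj₂ (x∈p∩q⁻ (N y) _ w∈)))))

  AllBornPlaced : Config order → Set
  AllBornPlaced c = ∀ {u v} → u ∈ Config.born c → v ∈ Config.born c → v ∈ N u → v ∈ Config.placed c u

  -- An unplaced edge at a vertex of `X` leads to an unborn vertex, which by `twins` is also a
  -- neighbour of `u`. Thus one empty row allows the whole cable to be closed.
  close-next : ∀ {c} → Stage c → AllBornPlaced c → ∀ {X u} → X ∈ˡ Config.live c → u ∈ X →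
               ¬ Nonempty (N u ∩ ∁ (Config.born c)) → NextStage c
  close-next {c} stage allPlaced {X} {u} X∈ u∈X emptyRow = close X , legal , record
    { sound = apply-Sound G (close X) legal sound
    ; i≤n   = i≤n
    ; born≡ = born≡
    ; twins = twins ∘ proj₁ ∘ ∈-without⁻ {L = live} {X}
    ; ℓ≤1+k = ℕ.≤-trans (ℕ.<⇒≤ (length-without X∈)) ℓ≤1+k
    } , 2*ℓ∸1≤ ℓ≤1+k
    where
    open Config c
    open Stage stage
    open Sound sound
    open Valid valid
    legal : Legal G c (close X)
    legal = X∈ , λ x v x∈X v∈N → decidable-stable (v ∈? placed x) λ v∉ →
      emptyRow (v , ∈-row⁺ G (proj₁ (twins X∈ x∈X u∈X v∈N v∉)) λ v∈born →
        v∉ (allPlaced (All.lookup live-born X∈ x∈X) v∈born v∈N))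

  -- All unplaced neighbours are unborn here, so rows record them exactly. Such a `w` passes from
  -- one cable to the other by `twins`, then `rows≡`, then `twins` again; being unborn, it stays
  -- unplaced.
  fold-next : ∀ {c} → Stage c → AllBornPlaced c → ∀ {X Y x y} →
              X ∈ˡ Config.live c → Y ∈ˡ Config.live c → X ≢ Y → x ∈ X → y ∈ Y →
              N x ∩ ∁ (Config.born c) ≡ N y ∩ ∁ (Config.born c) → NextStage c
  fold-next {c} stage allPlaced {X} {Y} {x} {y} X∈ Y∈ X≢Y x∈X y∈Y rows≡ = fold X Y , legal , record
    { sound = apply-Sound G (fold X Y) legal sound
    ; i≤n   = i≤n
    ; born≡ = born≡
    ; twins = twins′
    ; ℓ≤1+k = ℕ.≤-trans (ℕ.<⇒≤ (length-fold G {c} X∈ Y∈ X≢Y)) ℓ≤1+k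
    } , 2*ℓ∸1≤ ℓ≤1+k
    where
    open Config c
    open Stage stage
    open Sound sound
    open Valid valid
    legal : Legal G c (fold X Y)
    legal = X∈ , Y∈ , X≢Y
    cross : ∀ {X Y x y u v w} → X ∈ˡ live → Y ∈ˡ live → x ∈ X → y ∈ Y →
            N x ∩ ∁ born ≡ N y ∩ ∁ born → u ∈ X → v ∈ Y → w ∈ N u → w ∉ placed u →
            w ∈ N v × w ∉ placed v
    cross {x = x} {y} {w = w} X∈ Y∈ x∈X y∈Y rows≡ u∈X v∈Y w∈N w∉ with twins X∈ u∈X x∈X w∈N w∉
    ... | w∈Nx , w∉x = twins Y∈ y∈Y v∈Y
      (proj₁ (∈-row⁻ G y (subst (w ∈_) rows≡ (∈-row⁺ G w∈Nx w∉born)))) (w∉born ∘ placed-born)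
      where
      w∉born : w ∉ born
      w∉born w∈born = w∉x (allPlaced (All.lookup live-born X∈ x∈X) w∈born w∈Nx)
    twins′ : ∀ {Z u v w} → Z ∈ˡ Config.live (apply G c (fold X Y)) → u ∈ Z → v ∈ Z → w ∈ N u →
             w ∉ placed u → w ∈ N v × w ∉ placed v
    twins′ (here refl) u∈ v∈ with x∈p∪q⁻ X Y u∈ | x∈p∪q⁻ X Y v∈
    ... | inj₁ u∈X | inj₁ v∈X = twins X∈ u∈X v∈X
    ... | inj₂ u∈Y | inj₂ v∈Y = twins Y∈ u∈Y v∈Y
    ... | inj₁ u∈X | inj₂ v∈Y = cross X∈ Y∈ x∈X y∈Y rows≡ u∈X v∈Y
    ... | inj₂ u∈Y | inj₁ v∈X = cross Y∈ X∈ y∈Y x∈X (sym rows≡) u∈Y v∈X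
    twins′ (there Z∈) =
      twins (proj₁ (∈-without⁻ {L = live} {X} (proj₁ (∈-without⁻ {L = live without X} {Y} Z∈))))

  birth-next : ∀ {c} (stage : Stage c) → Stage.i stage < order → Config.ℓ c ≤ k → NextStage c
  birth-next {c} stage i<n ℓ≤k = birth ⁅ v ⁆ , legal , record
    { sound = apply-Sound G (birth ⁅ v ⁆) legal sound
    ; i≤n   = i<n
    ; born≡ = trans (cong (_∪ ⁅ v ⁆) born≡) (prefix-suc i<n)
    ; twins = twins′
    ; ℓ≤1+k = s≤s ℓ≤k
    } , ℕ.+-mono-≤ (ℕ.*-monoʳ-≤ 2 ℓ≤k) (s≤s z≤n)
    where
    open Config c
    open Stage stage
    v = π ⟨$⟩ʳ fromℕ< i<n
    legal : Legal G c (birth ⁅ v ⁆)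
    legal = (v , x∈⁅x⁆ v) , λ (u , u∈) → let (u∈v , u∈born) = x∈p∩q⁻ ⁅ v ⁆ born u∈ in
      ∉-prefix i<n (subst (_∈ prefix G π i) (x∈⁅y⁆⇒x≡y v u∈v) (subst (u ∈_) born≡ u∈born))
    twins′ : ∀ {Z x y w} → Z ∈ˡ ⁅ v ⁆ ∷ live → x ∈ Z → y ∈ Z → w ∈ N x → w ∉ placed x →
             w ∈ N y × w ∉ placed y
    twins′ (here refl) x∈ y∈ w∈N w∉ with x∈⁅y⁆⇒x≡y v x∈ | x∈⁅y⁆⇒x≡y v y∈
    ... | refl | refl = w∈N , w∉
    twins′ (there Z∈) = twins Z∈

  -- Configurations with nothing left to close or fold

  module _ {c : Config order} where
    open Config c

    HasEmptyRow : Subset order → Set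
    HasEmptyRow X = ∃ λ u → u ∈ X × ¬ Nonempty (N u ∩ ∁ born)

    hasEmptyRow? : ∀ X → Dec (HasEmptyRow X)
    hasEmptyRow? X = Fin.any? λ u → u ∈? X ×-dec ¬? (nonempty? (N u ∩ ∁ born))

    Foldable : Subset order → Subset order → Set
    Foldable X Y = X ≢ Y × ∃₂ λ x y → x ∈ X × y ∈ Y × N x ∩ ∁ born ≡ N y ∩ ∁ born

    foldable? : ∀ X Y → Dec (Foldable X Y)
    foldable? X Y = ¬? (X ≟ˢ Y) ×-dec Fin.any? λ x → Fin.any? λ y →
      x ∈? X ×-dec y ∈? Y ×-dec (N x ∩ ∁ born ≟ˢ N y ∩ ∁ born)

    -- Every cable has a nonzero row, and two cables sharing a row could be folded, so cables inject
    -- into active rows. This makes room for the next birth.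
    settled : (stage : Stage c) →
              ¬ Any HasEmptyRow live → ¬ Any (λ X → Any (Foldable X) live) live →
              ℓ ≤ length (activeRows G π (Stage.i stage))
    settled stage noEmptyRow noFold =
      length-≤-of-injective {R = RowOf} (disjoint⇒Unique live-nonempty live-disjoint) injective total
      where
      open Stage stage
      open Sound sound
      open Valid valid
      RowOf : Subset order → Subset order → Set
      RowOf X R = ∃ λ u → u ∈ X × R ≡ N u ∩ ∁ born
      injective : ∀ {X Y R} → X ∈ˡ live → Y ∈ˡ live → RowOf X R → RowOf Y R → X ≡ Y
      injective {X} {Y} X∈ Y∈ (x , x∈X , R≡x) (y , y∈Y , R≡y) = decidable-stable (X ≟ˢ Y) λ X≢Y →
        noFold (lose X∈ (lose Y∈ (X≢Y , x , y , x∈X , y∈Y , trans (sym R≡x) R≡y)))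
      total : ∀ {X} → X ∈ˡ live → Any (RowOf X) (activeRows G π i)
      total {X} X∈ with All.lookup live-nonempty X∈
      ... | u , u∈X = lose
        (∈-activeRows⁺ G {π} {i} (activeRow (subst (u ∈_) born≡ (All.lookup live-born X∈ u∈X))
                                            (cong (λ P → N u ∩ ∁ P) born≡) row≢∅))
        (u , u∈X , refl)
        where
        row≢∅ : Nonempty (N u ∩ ∁ born)
        row≢∅ = decidable-stable (nonempty? _) λ empty → noEmptyRow (lose X∈ (u , u∈X , empty))

    -- Once all vertices are born every row is empty, so any remaining cable would contradict
    -- `noEmptyRow`.
    completed : (stage : Stage c) → AllBornPlaced c → ¬ Any HasEmptyRow live →
                order ≤ Stage.i stage → Finished G c
    completed stage allPlaced noEmptyRow n≤i =
      allBorn , (λ u v → allPlaced (allBorn u) (allBorn v)) , noLive live id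
      where
      open Stage stage
      open Sound sound
      open Valid valid
      allBorn : ∀ v → v ∈ born
      allBorn v = subst (v ∈_) (sym born≡)
        (∈⟪⟫⁺ (λ u → toℕ (π ⟨$⟩ˡ u) <? i) (ℕ.<-≤-trans (Fin.toℕ<n (π ⟨$⟩ˡ v)) n≤i))
      noLive : ∀ L → (∀ {X} → X ∈ˡ L → X ∈ˡ live) → L ≡ []
      noLive []      _  = refl
      noLive (X ∷ _) L⊆ with All.lookup live-nonempty (L⊆ (here refl))
      ... | u , u∈X = contradiction
        (lose (L⊆ (here refl)) (u , u∈X , λ (w , w∈) → proj₂ (∈-row⁻ G u w∈) (allBorn w)))
        noEmptyRow

  -- Moves are tried in the order block, close, fold, birth: closes and folds rely on all edges
  -- between born vertices being placed, and a birth on `settled`.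
  next-stage : ∀ c → Stage c → Finished G c ⊎ NextStage c
  next-stage c stage = placing (Fin.any? λ u → Fin.any? λ v →
      u ∈? born ×-dec v ∈? born ×-dec v ∈? N u ×-dec ¬? (v ∈? placed u))
    where
    open Config c
    open Stage stage
    growing : AllBornPlaced c → ¬ Any (HasEmptyRow {c}) live →
              ¬ Any (λ X → Any (Foldable {c} X) live) live →
              Dec (i < order) → Finished G c ⊎ NextStage c
    growing allPlaced noEmptyRow noFold (yes i<n) = inj₂ (birth-next stage i<n
      (ℕ.≤-trans (settled stage noEmptyRow noFold) (length-activeRows≤k i≤n)))
    growing allPlaced noEmptyRow noFold (no i≮n) =
      inj₁ (completed stage allPlaced noEmptyRow (ℕ.≮⇒≥ i≮n))
    settling : AllBornPlaced c → Dec (Any (HasEmptyRow {c}) live) →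
               Dec (Any (λ X → Any (Foldable {c} X) live) live) → Finished G c ⊎ NextStage c
    settling allPlaced (yes closable) _ =
      let X , X∈ , u , u∈X , emptyRow = find closable
      in  inj₂ (close-next stage allPlaced X∈ u∈X emptyRow)
    settling allPlaced (no _) (yes foldable) =
      let X , X∈ , foldableX = find foldable
          Y , Y∈ , X≢Y , x , y , x∈X , y∈Y , rows≡ = find foldableX
      in  inj₂ (fold-next stage allPlaced X∈ Y∈ X≢Y x∈X y∈Y rows≡)
    settling allPlaced (no noEmptyRow) (no noFold) =
      growing allPlaced noEmptyRow noFold (i <? order)
    placing : Dec (∃₂ λ u v → u ∈ born × v ∈ born × v ∈ N u × v ∉ placed u) →
              Finished G c ⊎ NextStage c
    placing (yes (u , v , u∈ , v∈ , v∈N , v∉)) = inj₂ (block-next stage u∈ v∈ v∈N v∉)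
    placing (no noUnplaced) = settling
      (λ {u} {v} u∈ v∈ v∈N → decidable-stable (v ∈? placed u) λ v∉ →
        noUnplaced (u , v , u∈ , v∈ , v∈N , v∉))
      (Any.any? (hasEmptyRow? {c}) live) (Any.any? (λ X → Any.any? (foldable? {c} X) live) live)

  -- The recursion ends because every legal move lowers the potential.
  play : ∀ c → Acc _<_ (potential c) → Stage c →
         ∃₂ λ d (p : Play G c d) → Finished G d × width G p ≤ 2 * k + 2
  play c (acc rs) stage = continue (next-stage c stage)
    where
    continue : Finished G c ⊎ NextStage c →
               ∃₂ λ d (p : Play G c d) → Finished G d × width G p ≤ 2 * k + 2
    continue (inj₁ fin) = c , [] , fin , z≤n
    continue (inj₂ (m , legal , stage′ , cost≤)) =
      let d , p , fin , width≤ = play (apply G c m) (rs (apply-potential G m legal)) stage′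
      in  d , legal ∷ p , fin , ℕ.⊔-lub cost≤ width≤

-- Stated for arbitrary minima since the unifier would otherwise unfold anw and lsfw.
minima-compare : ∀ {P Q} (A : Minimum P) (L : Minimum Q) →
                 (∀ {w} → Q w → ∃ λ k → P k × 2 * k ≤ w) →
                 (∀ {k} → P k → ∃ λ w → Q w × w ≤ 2 * k + 2) →
                 2 * Minimum.value A ≤ Minimum.value L ×
                 Minimum.value L ≤ 2 * Minimum.value A + 2
minima-compare A L below above with below (Minimum.attained L) | above (Minimum.attained A)
... | k , Pk , 2k≤ | w , Qw , w≤ =
  ℕ.≤-trans (ℕ.*-monoʳ-≤ 2 (Minimum.minimal A Pk)) 2k≤ , ℕ.≤-trans (Minimum.minimal L Qw) w≤

theorem3p6 : (G : Graph) → 2 * anw G ≤ lsfw G × lsfw G ≤ 2 * anw G + 2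
theorem3p6 G = minima-compare (anwMinimum G) (lsfwMinimum G) below above
  where
  below : ∀ {w} → IsPlayWidth G w → ∃ λ k → IsLayoutWidth G k × 2 * k ≤ w
  below (_ , p , fin , refl) =
    let π , 2k≤ = births-layout G p fin in layoutWidth G π , (π , refl) , 2k≤
  above : ∀ {k} → IsLayoutWidth G k → ∃ λ w → IsPlayWidth G w × w ≤ 2 * k + 2
  above (π , refl) =
    let d , p , fin , width≤ = Greedy.play G π initial (<-wellFounded _) (Greedy.initial-Stage G π)
    in  width G p , (d , p , fin , refl) , width≤
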